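{- The $\lambda^{\textsc{prk}}_\eta$-calculus, i.e. $\lambda^{\textsc{prk}}$ extended with the reduction rule $$\mathsf{IC}^\pm_x.(t\bullet^\pm x)\ \to\ t\qquad\text{if } x\notin\mathsf{fv}(t)$$ (both signs equal, closed under arbitrary contexts), enjoys subject reduction (if $\Gamma\vdash t:P$ and $t\to s$ then $\Gamma\vdash s:P$), and it is strongly normalizing (there is no infinite reduction sequence from a typable term) and confluent (if $t_0$ is typable, $t_0\to^*t_1$ and $t_0\to^*t_2$, then there is $t_3$ with $t_1\to^*t_3$ and $t_2\to^*t_3$), where $\to$ denotes reduction in $\lambda^{\textsc{prk}}_\eta$.
   Context: **Types.** Fix a denumerable set of propositional variables $\alpha$. Pure propositions: $A,B ::= \alpha \mid A\land B\mid A\lor B\mid \neg A$. Types (moded propositions): $P,Q ::= A^+\mid A^-\mid A^\oplus\mid A^\ominus$; $A^+,A^-$ are strong, $A^\oplus,A^\ominus$ classical. Opposite: $(A^+)^\sim=A^-$, $(A^-)^\sim=A^+$, $(A^\oplus)^\sim=A^\ominus$, $(A^\ominus)^\sim=A^\oplus$. **Terms of $\lambda^{\textsc{prk}}$.** ($i\in\{1,2\}$, $\pm\in\{+,-\}$; $x,y$ from a denumerable set of variables) $$t,s,u ::= x \mid t\blacktriangleright\!\blacktriangleleft_P s\mid \langle t,s\rangle^\pm\mid \pi_i^\pm(t)\mid \mathsf{in}_i^\pm(t)\mid \delta^\pm t[_{x:P}.s][_{y:Q}.u]\mid \nu^\pm t\mid \mu^\pm t\mid \mathsf{IC}^\pm_{(x:P)}.t\mid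 t\bullet^\pm s.$$ In $\delta^\pm t[_{x:P}.s][_{y:Q}.u]$, $x$ is bound in $s$ and $y$ in $u$; in $\mathsf{IC}^\pm_{(x:P)}.t$, $x$ is bound in $t$. Terms are taken modulo $\alpha$-renaming; $\mathsf{fv}(t)$ is the set of free variables of $t$, and $t[x:=s]$ is capture-avoiding substitution. Type annotations may be omitted. **Typing.** Typing contexts $\Gamma$ are finite lists $x_1:P_1,\dots,x_n:P_n$ with distinct variables, up to reordering. A term $t$ is typable if $\Gamma\vdash t:P$ for some $\Gamma,P$. Rules: - (Ax) $\Gamma,x:P\vdash x:P$. (Abs) $\Gamma\vdash t:P$, $\Gamma\vdash s:P^\sim$, $P$ strong $\Rightarrow$ $\Gamma\vdash t\blacktriangleright\!\blacktriangleleft_Q s:Q$. - $\Gamma\vdash t:A^\oplus$, $\Gamma\vdash s:B^\oplus$ $\Rightarrow$ $\Gamma\vdash\langle t,s\rangle^+:(A\land B)^+$. $\Gamma\vdash t:A^\ominus$, $\Gamma\vdash s:B^\ominus$ $\Rightarrow$ $\Gamma\vdash\langle t,s\rangle^-:(A\lor B)^-$. - $\Gamma\vdash t:(A_1\land A_2)^+$ $\Rightarrow$ $\Gamma\vdash\pi^+_i(t):A_i^\oplus$. $\Gamma\vdash t:(A_1\lor A_2)^-$ $\Rightarrow$ $\Gamma\vdash\pi^-_i(t):A_i^\ominus$. - $\Gamma\vdash t:A_i^\oplus$ $\Rightarrow$ $\Gamma\vdash\mathsf{in}^+_i(t):(A_1\lor A_2)^+$. $\Gamma\vdash t:A_i^\ominus$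 $\Rightarrow$ $\Gamma\vdash\mathsf{in}^-_i(t):(A_1\land A_2)^-$. - $\Gamma\vdash t:(A\lor B)^+$, $\Gamma,x:A^\oplus\vdash s:P$, $\Gamma,y:B^\oplus\vdash u:P$ $\Rightarrow$ $\Gamma\vdash\delta^+t[_{x:A^\oplus}.s][_{y:B^\oplus}.u]:P$. $\Gamma\vdash t:(A\land B)^-$, $\Gamma,x:A^\ominus\vdash s:P$, $\Gamma,y:B^\ominus\vdash u:P$ $\Rightarrow$ $\Gamma\vdash\delta^-t[_{x:A^\ominus}.s][_{y:B^\ominus}.u]:P$. - $\Gamma\vdash t:A^\ominus$ $\Rightarrow$ $\Gamma\vdash\nu^+t:(\neg A)^+$. $\Gamma\vdash t:A^\oplus$ $\Rightarrow$ $\Gamma\vdash\nu^-t:(\neg A)^-$. $\Gamma\vdash t:(\neg A)^+$ $\Rightarrow$ $\Gamma\vdash\mu^+t:A^\ominus$. $\Gamma\vdash t:(\neg A)^-$ $\Rightarrow$ $\Gamma\vdash\mu^-t:A^\oplus$. - $\Gamma,x:A^\ominus\vdash t:A^+$ $\Rightarrow$ $\Gamma\vdash\mathsf{IC}^+_{(x:A^\ominus)}.t:A^\oplus$. $\Gamma,x:A^\oplus\vdash t:A^-$ $\Rightarrow$ $\Gamma\vdash\mathsf{IC}^-_{(x:A^\oplus)}.t:A^\ominus$. - $\Gamma\vdash t:A^\oplus$, $\Gamma\vdash s:A^\ominus$ $\Rightarrow$ $\Gamma\vdash t\bullet^+s:A^+$. $\Gamma\vdash t:A^\ominus$, $\Gamma\vdash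 s:A^\oplus$ $\Rightarrow$ $\Gamma\vdash t\bullet^-s:A^-$. **Generalized absurdity.** For $t:P$ and $s:P^\sim$, $t\bowtie_Q s$ denotes: $t\blacktriangleright\!\blacktriangleleft_Q s$ if $P$ is strong; $(t\bullet^+s)\blacktriangleright\!\blacktriangleleft_Q(s\bullet^-t)$ if $P=A^\oplus$; $(t\bullet^-s)\blacktriangleright\!\blacktriangleleft_Q(s\bullet^+t)$ if $P=A^\ominus$. **Reduction of $\lambda^{\textsc{prk}}$.** Defined on typable terms as the closure under arbitrary contexts of the following rules (in each rule all $\pm$ denote the same sign, $\mp$ the opposite sign, and $i\in\{1,2\}$); $\to^*$ denotes reflexive-transitive closure: - $\pi_i^\pm(\langle t_1,t_2\rangle^\pm)\to t_i$; - $\delta^\pm(\mathsf{in}_i^\pm(t))[_x.s_1][_x.s_2]\to s_i[x:=t]$; - $\mu^\pm(\nu^\pm t)\to t$; - $(\mathsf{IC}^\pm_x.t)\bullet^\pm s\to t[x:=s]$; - $\langle t_1,t_2\rangle^\pm\blacktriangleright\!\blacktriangleleft_Q\mathsf{in}_i^\mp(s)\to t_i\bowtie_Q s$; - $\mathsf{in}_i^\pm(t)\blacktriangleright\!\blacktriangleleft_Q\langle s_1,s_2\rangle^\mp\to t\bowtie_Q s_i$; - $(\nu^\pm t)\blacktriangleright\!\blacktriangleleft_Q(\nu^\mp s)\to t\bowtie_Q s$. -}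

module Defs where

open import Data.Fin.Base using (Fin; zero; suc)
open import Data.Nat.Base using (ℕ; suc)
open import Data.Product.Base using (∃-syntax)
open import Data.Sign.Base using (Sign; +; -; opposite)
open import Data.Vec.Base using (Vec; _∷_; lookup)
open import Relation.Binary.PropositionalEquality.Core using (_≡_)

infixr 6 _∧_ _∨_
infix  5 _^_
infix  8 _~

data Pure : Set where
  atom    : ℕ → Pure
  _∧_ _∨_ : Pure → Pure → Pure
  neg     : Pure → Pure

data Mode : Set where
  strong classical : Sign → Mode

pattern ⁺ = strong +
pattern ⁻ = strong -
pattern ⊕ = classical +
pattern ⊖ = classical -

data Type : Set where
  _^_ : Pure → Mode → Type

_~ : Type → Type
(A ^ strong p) ~    = A ^ strong (opposite p)
(A ^ classical p) ~ = A ^ classical (opposite p)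

data Strong : Type → Set where
  strong : (A : Pure) (p : Sign) → Strong (A ^ strong p)

-- The index i ∈ {1,2} is an element of Fin 2, and pick i x₁ x₂ is xᵢ.
pick : {X : Set} → Fin 2 → X → X → X
pick zero       x₁ x₂ = x₁
pick (suc zero) x₁ x₂ = x₂

infix 20 _▶◀[_]_
infix 21 _•⟨_⟩_
infix 30 ⟨_,_⟩^_

-- Terms modulo α-renaming, in well-scoped de Bruijn form: the free variables
-- of an element of Term n are among Fin n, and zero is the innermost binder.
-- δ p t P s Q u is δᵖ t [ x:P . s ] [ y:Q . u ], and IC p P t is ICᵖ_(x:P). t.
data Term (n : ℕ) : Set where
  var      : Fin n → Term n
  _▶◀[_]_  : Term n → Type → Term n → Term n
  ⟨_,_⟩^_  : Term n → Term n → Sign → Term n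
  π        : Sign → Fin 2 → Term n → Term n
  inj      : Sign → Fin 2 → Term n → Term n
  δ        : Sign → Term n → Type → Term (suc n) → Type → Term (suc n) → Term n
  ν        : Sign → Term n → Term n
  μ        : Sign → Term n → Term n
  IC       : Sign → Type → Term (suc n) → Term n
  _•⟨_⟩_   : Term n → Sign → Term n → Term n

private variable
  m n : ℕ

ext : (Fin m → Fin n) → Fin (suc m) → Fin (suc n)
ext ρ zero    = zero
ext ρ (suc x) = suc (ρ x)

rename : (Fin m → Fin n) → Term m → Term n
rename ρ (var x)         = var (ρ x)
rename ρ (t ▶◀[ P ] s)   = rename ρ t ▶◀[ P ] rename ρ s
rename ρ (⟨ t , s ⟩^ p)  = ⟨ rename ρ t , rename ρ s ⟩^ p
rename ρ (π p i t)       = π p i (rename ρ t)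
rename ρ (inj p i t)     = inj p i (rename ρ t)
rename ρ (δ p t P s Q u) = δ p (rename ρ t) P (rename (ext ρ) s) Q (rename (ext ρ) u)
rename ρ (ν p t)         = ν p (rename ρ t)
rename ρ (μ p t)         = μ p (rename ρ t)
rename ρ (IC p P t)      = IC p P (rename (ext ρ) t)
rename ρ (t •⟨ p ⟩ s)    = rename ρ t •⟨ p ⟩ rename ρ s

weaken : Term n → Term (suc n)
weaken = rename suc

exts : (Fin m → Term n) → Fin (suc m) → Term (suc n)
exts σ zero    = var zero
exts σ (suc x) = weaken (σ x)

subst : (Fin m → Term n) → Term m → Term n
subst σ (var x)         = σ x
subst σ (t ▶◀[ P ] s)   = subst σ t ▶◀[ P ] subst σ s
subst σ (⟨ t , s ⟩^ p)  = ⟨ subst σ t , subst σ s ⟩^ p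
subst σ (π p i t)       = π p i (subst σ t)
subst σ (inj p i t)     = inj p i (subst σ t)
subst σ (δ p t P s Q u) = δ p (subst σ t) P (subst (exts σ) s) Q (subst (exts σ) u)
subst σ (ν p t)         = ν p (subst σ t)
subst σ (μ p t)         = μ p (subst σ t)
subst σ (IC p P t)      = IC p P (subst (exts σ) t)
subst σ (t •⟨ p ⟩ s)    = subst σ t •⟨ p ⟩ subst σ s

subst₀ : Term n → Fin (suc n) → Term n
subst₀ s zero    = s
subst₀ s (suc x) = var x

infix 22 _[_]

_[_] : Term (suc n) → Term n → Term n
t [ s ] = subst (subst₀ s) t

Ctx : ℕ → Set
Ctx = Vec Type

infix 3 _⊢_∶_

data _⊢_∶_ {n : ℕ} (Γ : Ctx n) : Term n → Type → Set where
  ax : ∀ {x P} → lookup Γ x ≡ P → Γ ⊢ var x ∶ P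

  abs : ∀ {P Q t s} → Strong P → Γ ⊢ t ∶ P → Γ ⊢ s ∶ P ~ → Γ ⊢ t ▶◀[ Q ] s ∶ Q

  I∧⁺ : ∀ {A B t s} → Γ ⊢ t ∶ A ^ ⊕ → Γ ⊢ s ∶ B ^ ⊕ → Γ ⊢ ⟨ t , s ⟩^ + ∶ (A ∧ B) ^ ⁺
  I∨⁻ : ∀ {A B t s} → Γ ⊢ t ∶ A ^ ⊖ → Γ ⊢ s ∶ B ^ ⊖ → Γ ⊢ ⟨ t , s ⟩^ - ∶ (A ∨ B) ^ ⁻

  E∧⁺ : ∀ {A₁ A₂ t} (i : Fin 2) → Γ ⊢ t ∶ (A₁ ∧ A₂) ^ ⁺ → Γ ⊢ π + i t ∶ pick i A₁ A₂ ^ ⊕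
  E∨⁻ : ∀ {A₁ A₂ t} (i : Fin 2) → Γ ⊢ t ∶ (A₁ ∨ A₂) ^ ⁻ → Γ ⊢ π - i t ∶ pick i A₁ A₂ ^ ⊖

  I∨⁺ : ∀ {A₁ A₂ t} (i : Fin 2) → Γ ⊢ t ∶ pick i A₁ A₂ ^ ⊕ → Γ ⊢ inj + i t ∶ (A₁ ∨ A₂) ^ ⁺
  I∧⁻ : ∀ {A₁ A₂ t} (i : Fin 2) → Γ ⊢ t ∶ pick i A₁ A₂ ^ ⊖ → Γ ⊢ inj - i t ∶ (A₁ ∧ A₂) ^ ⁻

  E∨⁺ : ∀ {A B P t s u} → Γ ⊢ t ∶ (A ∨ B) ^ ⁺ →
        (A ^ ⊕) ∷ Γ ⊢ s ∶ P → (B ^ ⊕) ∷ Γ ⊢ u ∶ P →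
        Γ ⊢ δ + t (A ^ ⊕) s (B ^ ⊕) u ∶ P
  E∧⁻ : ∀ {A B P t s u} → Γ ⊢ t ∶ (A ∧ B) ^ ⁻ →
        (A ^ ⊖) ∷ Γ ⊢ s ∶ P → (B ^ ⊖) ∷ Γ ⊢ u ∶ P →
        Γ ⊢ δ - t (A ^ ⊖) s (B ^ ⊖) u ∶ P

  I¬⁺ : ∀ {A t} → Γ ⊢ t ∶ A ^ ⊖ → Γ ⊢ ν + t ∶ neg A ^ ⁺
  I¬⁻ : ∀ {A t} → Γ ⊢ t ∶ A ^ ⊕ → Γ ⊢ ν - t ∶ neg A ^ ⁻

  E¬⁺ : ∀ {A t} → Γ ⊢ t ∶ neg A ^ ⁺ → Γ ⊢ μ + t ∶ A ^ ⊖
  E¬⁻ : ∀ {A t} → Γ ⊢ t ∶ neg A ^ ⁻ → Γ ⊢ μ - t ∶ A ^ ⊕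

  IC⁺ : ∀ {A t} → (A ^ ⊖) ∷ Γ ⊢ t ∶ A ^ ⁺ → Γ ⊢ IC + (A ^ ⊖) t ∶ A ^ ⊕
  IC⁻ : ∀ {A t} → (A ^ ⊕) ∷ Γ ⊢ t ∶ A ^ ⁻ → Γ ⊢ IC - (A ^ ⊕) t ∶ A ^ ⊖

  EC⁺ : ∀ {A t s} → Γ ⊢ t ∶ A ^ ⊕ → Γ ⊢ s ∶ A ^ ⊖ → Γ ⊢ t •⟨ + ⟩ s ∶ A ^ ⁺
  EC⁻ : ∀ {A t s} → Γ ⊢ t ∶ A ^ ⊖ → Γ ⊢ s ∶ A ^ ⊕ → Γ ⊢ t •⟨ - ⟩ s ∶ A ^ ⁻

Typable : Term n → Set
Typable {n} t = ∃[ Γ ] ∃[ P ] Γ ⊢ t ∶ P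

-- bowtie M Q t s is the generalized absurdity t ⋈_Q s for t : P and s : P ~,
-- where M is the mode of P, the only part of P that matters.
bowtie : Mode → Type → Term n → Term n → Term n
bowtie (strong _) Q t s = t ▶◀[ Q ] s
bowtie ⊕          Q t s = (t •⟨ + ⟩ s) ▶◀[ Q ] (s •⟨ - ⟩ t)
bowtie ⊖          Q t s = (t •⟨ - ⟩ s) ▶◀[ Q ] (s •⟨ + ⟩ t)

infix 3 _↦_ _↦η_ _⟶_

-- Rules of λᵖʳᵏ.  The modes given to bowtie are those that typability of the
-- left-hand side forces: components of ⟨_,_⟩^ p and arguments of inj p have
-- mode classical p, arguments of ν p have mode classical (opposite p).
data _↦_ {n : ℕ} : Term n → Term n → Set where
  π-pair  : ∀ p i {t₁ t₂} → π p i (⟨ t₁ , t₂ ⟩^ p) ↦ pick i t₁ t₂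
  δ-inj   : ∀ p i {t P Q s₁ s₂} → δ p (inj p i t) P s₁ Q s₂ ↦ pick i s₁ s₂ [ t ]
  μ-ν     : ∀ p {t} → μ p (ν p t) ↦ t
  IC-•    : ∀ p {P t s} → IC p P t •⟨ p ⟩ s ↦ t [ s ]
  ▶◀-pair : ∀ p i {Q t₁ t₂ s} →
            ⟨ t₁ , t₂ ⟩^ p ▶◀[ Q ] inj (opposite p) i s ↦
            bowtie (classical p) Q (pick i t₁ t₂) s
  ▶◀-inj  : ∀ p i {Q t s₁ s₂} →
            inj p i t ▶◀[ Q ] ⟨ s₁ , s₂ ⟩^ (opposite p) ↦
            bowtie (classical p) Q t (pick i s₁ s₂)
  ▶◀-ν    : ∀ p {Q t s} →
            ν p t ▶◀[ Q ] ν (opposite p) s ↦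
            bowtie (classical (opposite p)) Q t s

-- The side condition x ∉ fv(t) is expressed by weaken t, which does not
-- mention the variable bound by IC.
data _↦η_ {n : ℕ} : Term n → Term n → Set where
  prk : ∀ {t u} → t ↦ u → t ↦η u
  η   : ∀ p {P t} → IC p P (weaken t •⟨ p ⟩ var zero) ↦η t

-- Reduction of λᵖʳᵏ_η, as a relation on raw terms; only its behaviour on
-- typable terms is meaningful.
data _⟶_ {n : ℕ} : Term n → Term n → Set where
  root   : ∀ {t u} → t ↦η u → t ⟶ u
  ξ-▶◀₁  : ∀ {Q t t′ s} → t ⟶ t′ → t ▶◀[ Q ] s ⟶ t′ ▶◀[ Q ] s
  ξ-▶◀₂  : ∀ {Q t s s′} → s ⟶ s′ → t ▶◀[ Q ] s ⟶ t ▶◀[ Q ] s′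
  ξ-pair₁ : ∀ {p t t′ s} → t ⟶ t′ → ⟨ t , s ⟩^ p ⟶ ⟨ t′ , s ⟩^ p
  ξ-pair₂ : ∀ {p t s s′} → s ⟶ s′ → ⟨ t , s ⟩^ p ⟶ ⟨ t , s′ ⟩^ p
  ξ-π    : ∀ {p i t t′} → t ⟶ t′ → π p i t ⟶ π p i t′
  ξ-inj  : ∀ {p i t t′} → t ⟶ t′ → inj p i t ⟶ inj p i t′
  ξ-δ₀   : ∀ {p t t′ P s Q u} → t ⟶ t′ → δ p t P s Q u ⟶ δ p t′ P s Q u
  ξ-δ₁   : ∀ {p t P s s′ Q u} → s ⟶ s′ → δ p t P s Q u ⟶ δ p t P s′ Q u
  ξ-δ₂   : ∀ {p t P s Q u u′} → u ⟶ u′ → δ p t P s Q u ⟶ δ p t P s Q u′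
  ξ-ν    : ∀ {p t t′} → t ⟶ t′ → ν p t ⟶ ν p t′
  ξ-μ    : ∀ {p t t′} → t ⟶ t′ → μ p t ⟶ μ p t′
  ξ-IC   : ∀ {p P t t′} → t ⟶ t′ → IC p P t ⟶ IC p P t′
  ξ-•₁   : ∀ {p t t′ s} → t ⟶ t′ → t •⟨ p ⟩ s ⟶ t′ •⟨ p ⟩ s
  ξ-•₂   : ∀ {p t s s′} → s ⟶ s′ → t •⟨ p ⟩ s ⟶ t •⟨ p ⟩ s′

{-# OPTIONS --safe #-}

-- Strong normalisation goes through an inductive predicate Sn on typed terms, in which head
-- redexes are contracted first and case distinctions on neutral terms are commuted outwards.
-- The crux is that Sn is closed under substitution for a variable of classical type, by induction
-- on the rank of the proposition A.  Since A ^ ⊕ and A ^ ⊖ behave like mutually recursive function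
-- types A ^ ⊖ → A ^ ⁺ and A ^ ⊕ → A ^ ⁻, the usual reducibility argument would need a fixed point
-- that is not strictly positive.  Instead, let X be the set of terms of type A ^ ⊕ that may be
-- applied to every Sn term of type A ^ ⊖.  First, substituting elements of X preserves Sn, so each
-- Sn term of type A ^ ⊖ may be applied to each element of X; using this, substituting Sn terms of
-- type A ^ ⊖ preserves Sn, so X contains every Sn term of type A ^ ⊕.
-- Confluence follows by Newman's lemma; the critical pair of η with the contraction of IC inside
-- it, on IC x. (IC y. t) • x, closes because typability makes the two annotations agree.

module Submission where

open import Data.Empty using (⊥-elim)
open import Data.Fin.Base using (Fin; zero; suc)
open import Data.Maybe.Base using (Maybe; just; nothing)
open import Data.Nat.Base using (ℕ; zero; suc; _⊔_; _≤_; _<_; s≤s)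
open import Data.Nat.Properties using (m≤m⊔n; m≤n⊔m; ≤-trans; ≤-refl; <⇒≤; n<1+n)
open import Data.Product.Base using (_×_; _,_; ∃-syntax; Σ-syntax; proj₁; proj₂)
open import Data.Sign.Base using (Sign; +; -; opposite)
open import Data.Sum.Base using (_⊎_; inj₁; inj₂)
open import Data.Vec.Base using (_∷_; lookup)
open import Function.Base using (_∘_; id; flip; case_of_)
open import Induction.WellFounded using (Acc; acc)
open import Relation.Binary.Construct.Closure.ReflexiveTransitive
  using (Star; ε; _◅_; _◅◅_; gmap)
open import Relation.Binary.PropositionalEquality
  using (_≡_; refl; sym; trans; cong; cong₂) renaming (subst to transport; subst₂ to transport₂)
open import Relation.Nullary.Negation.Core using (¬_)
open import Defs

private variable
  l m n : ℕ
  Γ : Ctx m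
  Δ : Ctx n

-- Algebra of renaming and substitution

cong-δ : ∀ {p P Q} {t t′ : Term n} {s s′ u u′} → t ≡ t′ → s ≡ s′ → u ≡ u′ →
         δ p t P s Q u ≡ δ p t′ P s′ Q u′
cong-δ refl refl refl = refl

ext-∘ : {ρ : Fin l → Fin m} {ρ′ : Fin m → Fin n} {ρ″ : Fin l → Fin n} →
        (∀ x → ρ′ (ρ x) ≡ ρ″ x) → ∀ x → ext ρ′ (ext ρ x) ≡ ext ρ″ x
ext-∘ eq zero    = refl
ext-∘ eq (suc x) = cong suc (eq x)

-- The fusion laws take the composite map as a parameter, related to its factors only pointwise. No
-- equality of functions is invoked, and going under a binder only asks that the pointwise
-- hypothesis lift along `ext` or `exts`.
rename-∘ : {ρ : Fin l → Fin m} {ρ′ : Fin m → Fin n} {ρ″ : Fin l → Fin n} →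
           (∀ x → ρ′ (ρ x) ≡ ρ″ x) → ∀ t → rename ρ′ (rename ρ t) ≡ rename ρ″ t
rename-∘ eq (var x)         = cong var (eq x)
rename-∘ eq (t ▶◀[ P ] s)   = cong₂ _▶◀[ P ]_ (rename-∘ eq t) (rename-∘ eq s)
rename-∘ eq (⟨ t , s ⟩^ p)  = cong₂ (⟨_,_⟩^ p) (rename-∘ eq t) (rename-∘ eq s)
rename-∘ eq (π p i t)       = cong (π p i) (rename-∘ eq t)
rename-∘ eq (inj p i t)     = cong (inj p i) (rename-∘ eq t)
rename-∘ eq (δ p t P s Q u) =
  cong-δ (rename-∘ eq t) (rename-∘ (ext-∘ eq) s) (rename-∘ (ext-∘ eq) u)
rename-∘ eq (ν p t)         = cong (ν p) (rename-∘ eq t)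
rename-∘ eq (μ p t)         = cong (μ p) (rename-∘ eq t)
rename-∘ eq (IC p P t)      = cong (IC p P) (rename-∘ (ext-∘ eq) t)
rename-∘ eq (t •⟨ p ⟩ s)    = cong₂ _•⟨ p ⟩_ (rename-∘ eq t) (rename-∘ eq s)

rename-weaken : (ρ : Fin m → Fin n) (t : Term m) →
                rename (ext ρ) (weaken t) ≡ weaken (rename ρ t)
rename-weaken ρ t = trans (rename-∘ (λ _ → refl) t) (sym (rename-∘ (λ _ → refl) t))

exts-ext : {ρ : Fin l → Fin m} {σ : Fin m → Term n} {τ : Fin l → Term n} →
           (∀ x → σ (ρ x) ≡ τ x) → ∀ x → exts σ (ext ρ x) ≡ exts τ x
exts-ext eq zero    = refl
exts-ext eq (suc x) = cong weaken (eq x)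

subst-rename : {ρ : Fin l → Fin m} {σ : Fin m → Term n} {τ : Fin l → Term n} →
               (∀ x → σ (ρ x) ≡ τ x) → ∀ t → subst σ (rename ρ t) ≡ subst τ t
subst-rename eq (var x)         = eq x
subst-rename eq (t ▶◀[ P ] s)   = cong₂ _▶◀[ P ]_ (subst-rename eq t) (subst-rename eq s)
subst-rename eq (⟨ t , s ⟩^ p)  = cong₂ (⟨_,_⟩^ p) (subst-rename eq t) (subst-rename eq s)
subst-rename eq (π p i t)       = cong (π p i) (subst-rename eq t)
subst-rename eq (inj p i t)     = cong (inj p i) (subst-rename eq t)
subst-rename eq (δ p t P s Q u) =
  cong-δ (subst-rename eq t) (subst-rename (exts-ext eq) s) (subst-rename (exts-ext eq) u)
subst-rename eq (ν p t)         = cong (ν p) (subst-rename eq t)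
subst-rename eq (μ p t)         = cong (μ p) (subst-rename eq t)
subst-rename eq (IC p P t)      = cong (IC p P) (subst-rename (exts-ext eq) t)
subst-rename eq (t •⟨ p ⟩ s)    = cong₂ _•⟨ p ⟩_ (subst-rename eq t) (subst-rename eq s)

ext-exts : {σ : Fin l → Term m} {ρ : Fin m → Fin n} {τ : Fin l → Term n} →
           (∀ x → rename ρ (σ x) ≡ τ x) → ∀ x → rename (ext ρ) (exts σ x) ≡ exts τ x
ext-exts eq zero    = refl
ext-exts {σ = σ} {ρ} eq (suc x) = trans (rename-weaken ρ (σ x)) (cong weaken (eq x))

rename-subst : {σ : Fin l → Term m} {ρ : Fin m → Fin n} {τ : Fin l → Term n} →
               (∀ x → rename ρ (σ x) ≡ τ x) → ∀ t → rename ρ (subst σ t) ≡ subst τ t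
rename-subst eq (var x)         = eq x
rename-subst eq (t ▶◀[ P ] s)   = cong₂ _▶◀[ P ]_ (rename-subst eq t) (rename-subst eq s)
rename-subst eq (⟨ t , s ⟩^ p)  = cong₂ (⟨_,_⟩^ p) (rename-subst eq t) (rename-subst eq s)
rename-subst eq (π p i t)       = cong (π p i) (rename-subst eq t)
rename-subst eq (inj p i t)     = cong (inj p i) (rename-subst eq t)
rename-subst eq (δ p t P s Q u) =
  cong-δ (rename-subst eq t) (rename-subst (ext-exts eq) s) (rename-subst (ext-exts eq) u)
rename-subst eq (ν p t)         = cong (ν p) (rename-subst eq t)
rename-subst eq (μ p t)         = cong (μ p) (rename-subst eq t)
rename-subst eq (IC p P t)      = cong (IC p P) (rename-subst (ext-exts eq) t)
rename-subst eq (t •⟨ p ⟩ s)    = cong₂ _•⟨ p ⟩_ (rename-subst eq t) (rename-subst eq s)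

subst-weaken : (σ : Fin m → Term n) (t : Term m) →
               subst (exts σ) (weaken t) ≡ weaken (subst σ t)
subst-weaken σ t = trans (subst-rename (λ _ → refl) t) (sym (rename-subst (λ _ → refl) t))

exts-exts : {σ : Fin l → Term m} {τ : Fin m → Term n} {υ : Fin l → Term n} →
            (∀ x → subst τ (σ x) ≡ υ x) → ∀ x → subst (exts τ) (exts σ x) ≡ exts υ x
exts-exts eq zero    = refl
exts-exts {σ = σ} {τ} eq (suc x) = trans (subst-weaken τ (σ x)) (cong weaken (eq x))

subst-∘ : {σ : Fin l → Term m} {τ : Fin m → Term n} {υ : Fin l → Term n} →
          (∀ x → subst τ (σ x) ≡ υ x) → ∀ t → subst τ (subst σ t) ≡ subst υ t
subst-∘ eq (var x)         = eq x
subst-∘ eq (t ▶◀[ P ] s)   = cong₂ _▶◀[ P ]_ (subst-∘ eq t) (subst-∘ eq s)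
subst-∘ eq (⟨ t , s ⟩^ p)  = cong₂ (⟨_,_⟩^ p) (subst-∘ eq t) (subst-∘ eq s)
subst-∘ eq (π p i t)       = cong (π p i) (subst-∘ eq t)
subst-∘ eq (inj p i t)     = cong (inj p i) (subst-∘ eq t)
subst-∘ eq (δ p t P s Q u) =
  cong-δ (subst-∘ eq t) (subst-∘ (exts-exts eq) s) (subst-∘ (exts-exts eq) u)
subst-∘ eq (ν p t)         = cong (ν p) (subst-∘ eq t)
subst-∘ eq (μ p t)         = cong (μ p) (subst-∘ eq t)
subst-∘ eq (IC p P t)      = cong (IC p P) (subst-∘ (exts-exts eq) t)
subst-∘ eq (t •⟨ p ⟩ s)    = cong₂ _•⟨ p ⟩_ (subst-∘ eq t) (subst-∘ eq s)

exts-var : {σ : Fin n → Term n} → (∀ x → σ x ≡ var x) → ∀ x → exts σ x ≡ var x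
exts-var eq zero    = refl
exts-var eq (suc x) = cong weaken (eq x)

subst-var : {σ : Fin n → Term n} → (∀ x → σ x ≡ var x) → ∀ t → subst σ t ≡ t
subst-var eq (var x)         = eq x
subst-var eq (t ▶◀[ P ] s)   = cong₂ _▶◀[ P ]_ (subst-var eq t) (subst-var eq s)
subst-var eq (⟨ t , s ⟩^ p)  = cong₂ (⟨_,_⟩^ p) (subst-var eq t) (subst-var eq s)
subst-var eq (π p i t)       = cong (π p i) (subst-var eq t)
subst-var eq (inj p i t)     = cong (inj p i) (subst-var eq t)
subst-var eq (δ p t P s Q u) =
  cong-δ (subst-var eq t) (subst-var (exts-var eq) s) (subst-var (exts-var eq) u)
subst-var eq (ν p t)         = cong (ν p) (subst-var eq t)
subst-var eq (μ p t)         = cong (μ p) (subst-var eq t)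
subst-var eq (IC p P t)      = cong (IC p P) (subst-var (exts-var eq) t)
subst-var eq (t •⟨ p ⟩ s)    = cong₂ _•⟨ p ⟩_ (subst-var eq t) (subst-var eq s)

infixr 5 _◂_

_◂_ : Term n → (Fin m → Term n) → Fin (suc m) → Term n
(s ◂ σ) zero    = s
(s ◂ σ) (suc x) = σ x

weaken-[] : (t s : Term n) → weaken t [ s ] ≡ t
weaken-[] t s = trans (subst-rename (λ _ → refl) t) (subst-var (λ _ → refl) t)

-- Going under a binder with `σ` and then instantiating it is one simultaneous substitution. This
-- merging lets the substitution lemma for `Sn` recurse on the body of an `IC` after a contraction.
exts-[] : (σ : Fin m → Term n) (s : Term n) (b : Term (suc m)) →
          subst (exts σ) b [ s ] ≡ subst (s ◂ σ) b
exts-[] σ s = subst-∘ λ { zero → refl ; (suc x) → weaken-[] (σ x) s }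

subst-[] : (σ : Fin m → Term n) (b : Term (suc m)) (s : Term m) →
           subst σ (b [ s ]) ≡ subst (exts σ) b [ subst σ s ]
subst-[] σ b s = trans (subst-∘ (λ { zero → refl ; (suc _) → refl }) b)
                       (sym (exts-[] σ (subst σ s) b))

rename-[] : (ρ : Fin m → Fin n) (b : Term (suc m)) (s : Term m) →
            rename ρ (b [ s ]) ≡ rename (ext ρ) b [ rename ρ s ]
rename-[] ρ b s = trans (rename-subst (λ _ → refl) b)
                        (sym (subst-rename (λ { zero → refl ; (suc _) → refl }) b))

pick-∘ : {X Y : Set} (f : X → Y) (i : Fin 2) {x₁ x₂ : X} →
         f (pick i x₁ x₂) ≡ pick i (f x₁) (f x₂)
pick-∘ f zero       = refl
pick-∘ f (suc zero) = refl

rename-bowtie : (ρ : Fin m → Fin n) (M : Mode) {Q : Type} {t s : Term m} →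
                rename ρ (bowtie M Q t s) ≡ bowtie M Q (rename ρ t) (rename ρ s)
rename-bowtie ρ (strong _) = refl
rename-bowtie ρ ⊕          = refl
rename-bowtie ρ ⊖          = refl

subst-bowtie : (σ : Fin m → Term n) (M : Mode) {Q : Type} {t s : Term m} →
               subst σ (bowtie M Q t s) ≡ bowtie M Q (subst σ t) (subst σ s)
subst-bowtie σ (strong _) = refl
subst-bowtie σ ⊕          = refl
subst-bowtie σ ⊖          = refl

subst-pick-[] : (σ : Fin m → Term n) (i : Fin 2) {t₁ t₂ : Term (suc m)} {w : Term m} →
                subst σ (pick i t₁ t₂ [ w ]) ≡
                pick i (subst (exts σ) t₁) (subst (exts σ) t₂) [ subst σ w ]
subst-pick-[] σ i {t₁} {t₂} {w} =
  trans (subst-[] σ (pick i t₁ t₂) w) (cong _[ _ ] (pick-∘ (subst (exts σ)) i))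

subst-bowtieˡ : (σ : Fin m → Term n) (M : Mode) (i : Fin 2) {Q : Type} {t₁ t₂ s : Term m} →
                subst σ (bowtie M Q (pick i t₁ t₂) s) ≡
                bowtie M Q (pick i (subst σ t₁) (subst σ t₂)) (subst σ s)
subst-bowtieˡ σ M i =
  trans (subst-bowtie σ M) (cong (λ t → bowtie M _ t _) (pick-∘ (subst σ) i))

subst-bowtieʳ : (σ : Fin m → Term n) (M : Mode) (i : Fin 2) {Q : Type} {t s₁ s₂ : Term m} →
                subst σ (bowtie M Q t (pick i s₁ s₂)) ≡
                bowtie M Q (subst σ t) (pick i (subst σ s₁) (subst σ s₂))
subst-bowtieʳ σ M i = trans (subst-bowtie σ M) (cong (bowtie M _ _) (pick-∘ (subst σ) i))

-- Sign-uniform type relations, elimination frames and stacked case distinctions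

data Opp : Sign → Sign → Set where
  +- : Opp + -
  -+ : Opp - +

-- `Prod`, `Sum` and `Neg` tabulate the strong types that a pair, an injection or a `ν` of sign `p`
-- inhabits, next to the types of the arguments. Each pair of dual typing rules then becomes a
-- single rule of `Sn` or `Ne`.
data Prod : Sign → Type → Type → Type → Set where
  ∧⁺ : ∀ {A B} → Prod + ((A ∧ B) ^ ⁺) (A ^ ⊕) (B ^ ⊕)
  ∨⁻ : ∀ {A B} → Prod - ((A ∨ B) ^ ⁻) (A ^ ⊖) (B ^ ⊖)

data Sum : Sign → Type → Type → Type → Set where
  ∨⁺ : ∀ {A B} → Sum + ((A ∨ B) ^ ⁺) (A ^ ⊕) (B ^ ⊕)
  ∧⁻ : ∀ {A B} → Sum - ((A ∧ B) ^ ⁻) (A ^ ⊖) (B ^ ⊖)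

data Neg : Sign → Type → Type → Set where
  ¬⁺ : ∀ {A} → Neg + (neg A ^ ⁺) (A ^ ⊖)
  ¬⁻ : ∀ {A} → Neg - (neg A ^ ⁻) (A ^ ⊕)

-- Elimination contexts of depth one, with the hole at a principal argument. An absurdity offers two
-- holes, because it contracts only when both sides are introductions.
data Frame (n : ℕ) : Set where
  app  : Sign → Term n → Frame n
  proj : Sign → Fin 2 → Frame n
  unν  : Sign → Frame n
  case : Sign → Type → Term (suc n) → Type → Term (suc n) → Frame n
  absˡ : Type → Term n → Frame n
  absʳ : Type → Term n → Frame n

plug : Frame n → Term n → Term n
plug (app p s) t        = t •⟨ p ⟩ s
plug (proj p i) t       = π p i t
plug (unν p) t          = μ p t
plug (case p P s Q u) t = δ p t P s Q u
plug (absˡ Q s) t       = t ▶◀[ Q ] s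
plug (absʳ Q s) t       = s ▶◀[ Q ] t

renameF : (Fin m → Fin n) → Frame m → Frame n
renameF ρ (app p s)        = app p (rename ρ s)
renameF ρ (proj p i)       = proj p i
renameF ρ (unν p)          = unν p
renameF ρ (case p P s Q u) = case p P (rename (ext ρ) s) Q (rename (ext ρ) u)
renameF ρ (absˡ Q s)       = absˡ Q (rename ρ s)
renameF ρ (absʳ Q s)       = absʳ Q (rename ρ s)

substF : (Fin m → Term n) → Frame m → Frame n
substF σ (app p s)        = app p (subst σ s)
substF σ (proj p i)       = proj p i
substF σ (unν p)          = unν p
substF σ (case p P s Q u) = case p P (subst (exts σ) s) Q (subst (exts σ) u)
substF σ (absˡ Q s)       = absˡ Q (subst σ s)
substF σ (absʳ Q s)       = absʳ Q (subst σ s)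

weakenF : Frame n → Frame (suc n)
weakenF = renameF suc

rename-plug : (ρ : Fin m → Fin n) (F : Frame m) {t : Term m} →
              rename ρ (plug F t) ≡ plug (renameF ρ F) (rename ρ t)
rename-plug ρ (app _ _)        = refl
rename-plug ρ (proj _ _)       = refl
rename-plug ρ (unν _)          = refl
rename-plug ρ (case _ _ _ _ _) = refl
rename-plug ρ (absˡ _ _)       = refl
rename-plug ρ (absʳ _ _)       = refl

subst-plug : (σ : Fin m → Term n) (F : Frame m) {t : Term m} →
             subst σ (plug F t) ≡ plug (substF σ F) (subst σ t)
subst-plug σ (app _ _)        = refl
subst-plug σ (proj _ _)       = refl
subst-plug σ (unν _)          = refl
subst-plug σ (case _ _ _ _ _) = refl
subst-plug σ (absˡ _ _)       = refl
subst-plug σ (absʳ _ _)       = refl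

ext-ext-suc : (ρ : Fin m → Fin n) (s : Term (suc m)) →
              rename (ext (ext ρ)) (rename (ext suc) s) ≡ rename (ext suc) (rename (ext ρ) s)
ext-ext-suc ρ s = trans (rename-∘ (ext-∘ (λ _ → refl)) s) (sym (rename-∘ (ext-∘ (λ _ → refl)) s))

exts-ext-suc : (σ : Fin m → Term n) (s : Term (suc m)) →
               subst (exts (exts σ)) (rename (ext suc) s) ≡ rename (ext suc) (subst (exts σ) s)
exts-ext-suc σ s =
  trans (subst-rename (exts-ext (λ _ → refl)) s) (sym (rename-subst (ext-exts (λ _ → refl)) s))

renameF-weakenF : (ρ : Fin m → Fin n) (F : Frame m) →
                  renameF (ext ρ) (weakenF F) ≡ weakenF (renameF ρ F)
renameF-weakenF ρ (app p s)        = cong (app p) (rename-weaken ρ s)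
renameF-weakenF ρ (proj _ _)       = refl
renameF-weakenF ρ (unν _)          = refl
renameF-weakenF ρ (case p P s Q u) =
  cong₂ (λ s u → case p P s Q u) (ext-ext-suc ρ s) (ext-ext-suc ρ u)
renameF-weakenF ρ (absˡ Q s)       = cong (absˡ Q) (rename-weaken ρ s)
renameF-weakenF ρ (absʳ Q s)       = cong (absʳ Q) (rename-weaken ρ s)

substF-weakenF : (σ : Fin m → Term n) (F : Frame m) →
                 substF (exts σ) (weakenF F) ≡ weakenF (substF σ F)
substF-weakenF σ (app p s)        = cong (app p) (subst-weaken σ s)
substF-weakenF σ (proj _ _)       = refl
substF-weakenF σ (unν _)          = refl
substF-weakenF σ (case p P s Q u) =
  cong₂ (λ s u → case p P s Q u) (exts-ext-suc σ s) (exts-ext-suc σ u)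
substF-weakenF σ (absˡ Q s)       = cong (absˡ Q) (subst-weaken σ s)
substF-weakenF σ (absʳ Q s)       = cong (absʳ Q) (subst-weaken σ s)

-- t is K⟨ δᵖ v [ P . s₁ ] [ Q . s₂ ] ⟩ for a stack of frames K, and tᵢ is K⟨ sᵢ ⟩.
data Split {n} (p : Sign) (P Q : Type) :
     Term n → Term n → Term (suc n) → Term (suc n) → Set where
  here  : ∀ {v s₁ s₂} → Split p P Q (δ p v P s₁ Q s₂) v s₁ s₂
  there : ∀ F {t v t₁ t₂} → Split p P Q t v t₁ t₂ →
          Split p P Q (plug F t) v (plug (weakenF F) t₁) (plug (weakenF F) t₂)

rename-split : ∀ {p P Q} (ρ : Fin m → Fin n) {t v t₁ t₂} → Split p P Q t v t₁ t₂ →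
               Split p P Q (rename ρ t) (rename ρ v) (rename (ext ρ) t₁) (rename (ext ρ) t₂)
rename-split ρ here = here
rename-split ρ (there F {t₁ = t₁} {t₂} S)
  rewrite rename-plug (ext ρ) (weakenF F) {t₁} | rename-plug (ext ρ) (weakenF F) {t₂}
        | renameF-weakenF ρ F
  = transport (λ t → Split _ _ _ t _ _ _) (sym (rename-plug ρ F))
      (there (renameF ρ F) (rename-split ρ S))

subst-split : ∀ {p P Q} (σ : Fin m → Term n) {t v t₁ t₂} → Split p P Q t v t₁ t₂ →
              Split p P Q (subst σ t) (subst σ v) (subst (exts σ) t₁) (subst (exts σ) t₂)
subst-split σ here = here
subst-split σ (there F {t₁ = t₁} {t₂} S)
  rewrite subst-plug (exts σ) (weakenF F) {t₁} | subst-plug (exts σ) (weakenF F) {t₂}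
        | substF-weakenF σ F
  = transport (λ t → Split _ _ _ t _ _ _) (sym (subst-plug σ F))
      (there (substF σ F) (subst-split σ S))

-- The rule split plays the role of commuting conversions.  The judgement nothing is for
-- absurdities t ▶◀[ Q ] s, which behave alike for all Q.
mutual
  data Sn {n} (Γ : Ctx n) : Term n → Maybe Type → Set where
    ne    : ∀ {t P} → Ne Γ t P → Sn Γ t (just P)
    exp   : ∀ {t t′ J} → Γ ⊢ t ⇒ t′ → Sn Γ t′ J → Sn Γ t J
    split : ∀ {p P Q R t v t₁ t₂ J} → Sum p R P Q → Split p P Q t v t₁ t₂ → Ne Γ v R →
            Sn (P ∷ Γ) t₁ J → Sn (Q ∷ Γ) t₂ J → Sn Γ t J
    pair  : ∀ {p P Q R t s} → Prod p R P Q → Sn Γ t (just P) → Sn Γ s (just Q) →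
            Sn Γ (⟨ t , s ⟩^ p) (just R)
    inj   : ∀ {p P Q R t} i → Sum p R P Q → Sn Γ t (just (pick i P Q)) →
            Sn Γ (inj p i t) (just R)
    ν     : ∀ {p P R t} → Neg p R P → Sn Γ t (just P) → Sn Γ (ν p t) (just R)
    ic    : ∀ {p p′ A t} → Opp p p′ → Sn ((A ^ classical p′) ∷ Γ) t (just (A ^ strong p)) →
            Sn Γ (IC p (A ^ classical p′) t) (just (A ^ classical p))
    absˡ  : ∀ {p p′ A t Q s} → Opp p p′ → Ne Γ t (A ^ strong p) →
            Sn Γ s (just (A ^ strong p′)) → Sn Γ (t ▶◀[ Q ] s) nothing
    absʳ  : ∀ {p p′ A t Q s} → Opp p p′ → Sn Γ t (just (A ^ strong p)) →
            Ne Γ s (A ^ strong p′) → Sn Γ (t ▶◀[ Q ] s) nothing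

  -- An absurdity counts as neutral even when it still contains a redex: contracting it gives
  -- another absurdity, never an introduction. Case distinctions are absent, since `split` deals
  -- with them.
  data Ne {n} (Γ : Ctx n) : Term n → Type → Set where
    var  : ∀ {x P} → lookup Γ x ≡ P → Ne Γ (var x) P
    app  : ∀ {p p′ A t s} → Opp p p′ → Ne Γ t (A ^ classical p) →
           Sn Γ s (just (A ^ classical p′)) → Ne Γ (t •⟨ p ⟩ s) (A ^ strong p)
    proj : ∀ {p P Q R t} i → Prod p R P Q → Ne Γ t R → Ne Γ (π p i t) (pick i P Q)
    unν  : ∀ {p P R t} → Neg p R P → Ne Γ t R → Ne Γ (μ p t) P
    abs  : ∀ {t Q s} → Sn Γ (t ▶◀[ Q ] s) nothing → Ne Γ (t ▶◀[ Q ] s) Q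

  -- Head contraction. The `Sn` premises cover the subterms that the contraction may erase; those
  -- that survive are controlled by the contractum. In `δ-inj` the redex sits at the base of a whole
  -- stack, so that the contractum is an instance of a branch already placed under that stack.
  data _⊢_⇒_ {n} (Γ : Ctx n) : Term n → Term n → Set where
    β        : ∀ {p P t s J} → Sn Γ s J → Γ ⊢ IC p P t •⟨ p ⟩ s ⇒ t [ s ]
    π-pair   : ∀ {p J K t₁ t₂} i → Sn Γ t₁ J → Sn Γ t₂ K → Γ ⊢ π p i (⟨ t₁ , t₂ ⟩^ p) ⇒ pick i t₁ t₂
    μ-ν      : ∀ {p t} → Γ ⊢ μ p (ν p t) ⇒ t
    δ-inj    : ∀ {p P Q t w t₁ t₂ J K L} i → Split p P Q t (inj p i w) t₁ t₂ →
               Sn Γ w J → Sn (P ∷ Γ) t₁ K → Sn (Q ∷ Γ) t₂ L → Γ ⊢ t ⇒ pick i t₁ t₂ [ w ]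
    ▶◀-pair  : ∀ {p Q J K t₁ t₂ s} i → Sn Γ t₁ J → Sn Γ t₂ K →
               Γ ⊢ ⟨ t₁ , t₂ ⟩^ p ▶◀[ Q ] inj (opposite p) i s ⇒
                   bowtie (classical p) Q (pick i t₁ t₂) s
    ▶◀-inj   : ∀ {p Q J K t s₁ s₂} i → Sn Γ s₁ J → Sn Γ s₂ K →
               Γ ⊢ inj p i t ▶◀[ Q ] ⟨ s₁ , s₂ ⟩^ (opposite p) ⇒
                   bowtie (classical p) Q t (pick i s₁ s₂)
    ▶◀-ν     : ∀ {p Q t s} →
               Γ ⊢ ν p t ▶◀[ Q ] ν (opposite p) s ⇒ bowtie (classical (opposite p)) Q t s
    frame    : ∀ F {t t′} → Γ ⊢ t ⇒ t′ → Γ ⊢ plug F t ⇒ plug F t′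

-- Closure of `Sn` under renaming, projection and elimination of negation

reduct : ∀ {t t′ t″ : Term n} → t′ ≡ t″ → Γ ⊢ t ⇒ t″ → Γ ⊢ t ⇒ t′
reduct refl r = r

Renaming : Ctx m → Ctx n → (Fin m → Fin n) → Set
Renaming Γ Δ ρ = ∀ x → lookup Δ (ρ x) ≡ lookup Γ x

ext-Renaming : ∀ {ρ P} → Renaming Γ Δ ρ → Renaming (P ∷ Γ) (P ∷ Δ) (ext ρ)
ext-Renaming ρ∶ zero    = refl
ext-Renaming ρ∶ (suc x) = ρ∶ x

mutual
  rename-sn : ∀ {ρ} → Renaming Γ Δ ρ → ∀ {t J} → Sn Γ t J → Sn Δ (rename ρ t) J
  rename-sn ρ∶ (ne d)              = ne (rename-ne ρ∶ d)
  rename-sn ρ∶ (exp r d)           = exp (rename-⇒ ρ∶ r) (rename-sn ρ∶ d)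
  rename-sn ρ∶ (split c S d d₁ d₂) =
    split c (rename-split _ S) (rename-ne ρ∶ d)
      (rename-sn (ext-Renaming ρ∶) d₁) (rename-sn (ext-Renaming ρ∶) d₂)
  rename-sn ρ∶ (pair c d d′)       = pair c (rename-sn ρ∶ d) (rename-sn ρ∶ d′)
  rename-sn ρ∶ (inj i c d)         = inj i c (rename-sn ρ∶ d)
  rename-sn ρ∶ (ν c d)             = ν c (rename-sn ρ∶ d)
  rename-sn ρ∶ (ic o d)            = ic o (rename-sn (ext-Renaming ρ∶) d)
  rename-sn ρ∶ (absˡ o d d′)       = absˡ o (rename-ne ρ∶ d) (rename-sn ρ∶ d′)
  rename-sn ρ∶ (absʳ o d d′)       = absʳ o (rename-sn ρ∶ d) (rename-ne ρ∶ d′)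

  rename-ne : ∀ {ρ} → Renaming Γ Δ ρ → ∀ {t P} → Ne Γ t P → Ne Δ (rename ρ t) P
  rename-ne ρ∶ (var eq)     = var (trans (ρ∶ _) eq)
  rename-ne ρ∶ (app o d d′) = app o (rename-ne ρ∶ d) (rename-sn ρ∶ d′)
  rename-ne ρ∶ (proj i c d) = proj i c (rename-ne ρ∶ d)
  rename-ne ρ∶ (unν c d)    = unν c (rename-ne ρ∶ d)
  rename-ne ρ∶ (abs d)      = abs (rename-sn ρ∶ d)

  rename-⇒ : ∀ {ρ} → Renaming Γ Δ ρ → ∀ {t t′} → Γ ⊢ t ⇒ t′ → Δ ⊢ rename ρ t ⇒ rename ρ t′
  rename-⇒ {ρ = ρ} ρ∶ (β {t = t} {s} d) =
    reduct (rename-[] ρ t s) (β (rename-sn ρ∶ d))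
  rename-⇒ {ρ = ρ} ρ∶ (π-pair i d d′) =
    reduct (pick-∘ (rename ρ) i) (π-pair i (rename-sn ρ∶ d) (rename-sn ρ∶ d′))
  rename-⇒ ρ∶ μ-ν = μ-ν
  rename-⇒ {ρ = ρ} ρ∶ (δ-inj {w = w} {t₁} {t₂} i S d d₁ d₂) =
    reduct
      (trans (rename-[] ρ (pick i t₁ t₂) w) (cong _[ _ ] (pick-∘ (rename (ext ρ)) i)))
      (δ-inj i (rename-split ρ S) (rename-sn ρ∶ d)
        (rename-sn (ext-Renaming ρ∶) d₁) (rename-sn (ext-Renaming ρ∶) d₂))
  rename-⇒ {ρ = ρ} ρ∶ (▶◀-pair {p} i d d′) =
    reduct
      (trans (rename-bowtie ρ (classical p))
             (cong (λ t → bowtie (classical p) _ t _) (pick-∘ (rename ρ) i)))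
      (▶◀-pair i (rename-sn ρ∶ d) (rename-sn ρ∶ d′))
  rename-⇒ {ρ = ρ} ρ∶ (▶◀-inj {p} i d d′) =
    reduct
      (trans (rename-bowtie ρ (classical p))
             (cong (bowtie (classical p) _ _) (pick-∘ (rename ρ) i)))
      (▶◀-inj i (rename-sn ρ∶ d) (rename-sn ρ∶ d′))
  rename-⇒ {ρ = ρ} ρ∶ (▶◀-ν {p}) =
    reduct (rename-bowtie ρ (classical (opposite p))) ▶◀-ν
  rename-⇒ {ρ = ρ} ρ∶ (frame F r) =
    transport₂ (_ ⊢_⇒_) (sym (rename-plug ρ F)) (sym (rename-plug ρ F))
      (frame (renameF ρ F) (rename-⇒ ρ∶ r))

weaken-sn : ∀ {P t J} → Sn Γ t J → Sn (P ∷ Γ) (weaken t) J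
weaken-sn = rename-sn (λ _ → refl)

pick-sn : ∀ i {t₁ t₂ P Q} → Sn Γ t₁ (just P) → Sn Γ t₂ (just Q) →
          Sn Γ (pick i t₁ t₂) (just (pick i P Q))
pick-sn zero       d₁ d₂ = d₁
pick-sn (suc zero) d₁ d₂ = d₂

-- Induction on the `Sn` derivation pushes the projection through expansions and into the branches
-- of splits; at a pair the contractum is one of the premises.
proj-sn : ∀ {p P Q R t} i → Prod p R P Q → Sn Γ t (just R) → Sn Γ (π p i t) (just (pick i P Q))
proj-sn i c  (ne d)                = ne (proj i c d)
proj-sn i c  (exp r d)             = exp (frame (proj _ i) r) (proj-sn i c d)
proj-sn i c  (split c′ S d d₁ d₂)  =
  split c′ (there (proj _ i) S) d (proj-sn i c d₁) (proj-sn i c d₂)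
proj-sn i ∧⁺ (pair ∧⁺ d₁ d₂)       = exp (π-pair i d₁ d₂) (pick-sn i d₁ d₂)
proj-sn i ∨⁻ (pair ∨⁻ d₁ d₂)       = exp (π-pair i d₁ d₂) (pick-sn i d₁ d₂)
proj-sn i ∧⁺ (inj _ () _)
proj-sn i ∨⁻ (inj _ () _)
proj-sn i ∧⁺ (ν () _)
proj-sn i ∨⁻ (ν () _)

unν-sn : ∀ {p P R t} → Neg p R P → Sn Γ t (just R) → Sn Γ (μ p t) (just P)
unν-sn c  (ne d)                = ne (unν c d)
unν-sn c  (exp r d)             = exp (frame (unν _) r) (unν-sn c d)
unν-sn c  (split c′ S d d₁ d₂)  = split c′ (there (unν _) S) d (unν-sn c d₁) (unν-sn c d₂)
unν-sn ¬⁺ (ν ¬⁺ d)              = exp μ-ν d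
unν-sn ¬⁻ (ν ¬⁻ d)              = exp μ-ν d
unν-sn ¬⁺ (pair () _ _)
unν-sn ¬⁻ (pair () _ _)
unν-sn ¬⁺ (inj _ () _)
unν-sn ¬⁻ (inj _ () _)

split-step : ∀ {p P Q} {t v v′ : Term n} {t₁ t₂} {Γ : Ctx n} →
             Split p P Q t v t₁ t₂ → Γ ⊢ v ⇒ v′ →
             ∃[ t′ ] (Γ ⊢ t ⇒ t′ × Split p P Q t′ v′ t₁ t₂)
split-step here        r = _ , frame (case _ _ _ _ _) r , here
split-step (there F S) r with split-step S r
... | _ , r′ , S′ = _ , frame F r′ , there F S′

-- The commuting conversion for a case distinction whose scrutinee is again one: the inner
-- distinction becomes outermost, and each of its branches carries a copy of the outer distinction,
-- whose own branches are weakened by the new variable.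
split-split : ∀ {p P Q p′ P′ Q′} {t v u : Term n} {t₁ t₂ v₁ v₂} →
              Split p P Q t v t₁ t₂ → Split p′ P′ Q′ v u v₁ v₂ →
              ∃[ u₁ ] ∃[ u₂ ] (Split p′ P′ Q′ t u u₁ u₂
                × Split p P Q u₁ v₁ (rename (ext suc) t₁) (rename (ext suc) t₂)
                × Split p P Q u₂ v₂ (rename (ext suc) t₁) (rename (ext suc) t₂))
split-split here S′ = _ , _ , there (case _ _ _ _ _) S′ , here , here
split-split (there F {t₁ = t₁} {t₂} S) S′ with split-split S S′
... | _ , _ , S₀ , S₁ , S₂
  rewrite rename-plug (ext suc) (weakenF F) {t₁} | rename-plug (ext suc) (weakenF F) {t₂}
        | renameF-weakenF suc F
  = _ , _ , there F S₀ , there (weakenF F) S₁ , there (weakenF F) S₂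

-- Rank of propositions, and eliminations available from substitution at smaller ranks

rank : Pure → ℕ
rank (atom _) = 0
rank (A ∧ B)  = suc (rank A ⊔ rank B)
rank (A ∨ B)  = suc (rank A ⊔ rank B)
rank (neg A)  = suc (rank A)

-- The asymmetric bounds make smallness stable under elimination: the components of a strong type of
-- rank at most `k` are classical of rank below `k`, and applying a classical term keeps the
-- proposition. The bound for strong types also admits the result of applying a term of type
-- `A ^ classical p` with `rank A` equal to `k`.
Small : ℕ → Type → Set
Small k (A ^ strong _)    = rank A ≤ k
Small k (A ^ classical _) = rank A < k

small-l : ∀ {k} A B → suc (rank A ⊔ rank B) ≤ k → rank A < k
small-l A B = ≤-trans (s≤s (m≤m⊔n (rank A) (rank B)))

small-r : ∀ {k} A B → suc (rank A ⊔ rank B) ≤ k → rank B < k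
small-r A B = ≤-trans (s≤s (m≤n⊔m (rank A) (rank B)))

small-prod : ∀ {k p P Q R} i → Prod p R P Q → Small k R → Small k (pick i P Q)
small-prod zero       (∧⁺ {A} {B}) = small-l A B
small-prod zero       (∨⁻ {A} {B}) = small-l A B
small-prod (suc zero) (∧⁺ {A} {B}) = small-r A B
small-prod (suc zero) (∨⁻ {A} {B}) = small-r A B

small-neg : ∀ {k p P R} → Neg p R P → Small k R → Small k P
small-neg ¬⁺ r = r
small-neg ¬⁻ r = r

-- The induction hypothesis on rank. It speaks of classical types only, as every binder of the
-- calculus binds a variable of classical type.
SubstClosed : ℕ → Set
SubstClosed k = ∀ {n} {Γ : Ctx n} {A p b s J} → rank A < k →
  Sn ((A ^ classical p) ∷ Γ) b J → Sn Γ s (just (A ^ classical p)) → Sn Γ (b [ s ]) J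

module _ {k : ℕ} (sub : SubstClosed k) where

  -- Application is an instance of substitution: put `t` for the head variable of the neutral term
  -- `var zero •⟨ p ⟩ weaken s`.
  app-sn : ∀ {A p p′ t s} → rank A < k → Opp p p′ → Sn Γ t (just (A ^ classical p)) →
           Sn Γ s (just (A ^ classical p′)) → Sn Γ (t •⟨ p ⟩ s) (just (A ^ strong p))
  app-sn {t = t} {s} r o d d′ =
    transport (λ s → Sn _ (t •⟨ _ ⟩ s) _) (weaken-[] s t)
      (sub r (ne (app o (var refl) (weaken-sn d′))) d)

  -- The introductions of strong types, isolated so that an absurdity can be analysed first along
  -- the derivation of its left side and then, with that side fixed as a value, along the derivation
  -- of its right side.
  data Value (Γ : Ctx n) : Term n → Type → Set where
    pair : ∀ {p P Q R t s} → Prod p R P Q → Sn Γ t (just P) → Sn Γ s (just Q) →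
           Value Γ (⟨ t , s ⟩^ p) R
    inj  : ∀ {p P Q R t} i → Sum p R P Q → Sn Γ t (just (pick i P Q)) → Value Γ (inj p i t) R
    ν    : ∀ {p P R t} → Neg p R P → Sn Γ t (just P) → Value Γ (ν p t) R

  value-sn : ∀ {t P} → Value Γ t P → Sn Γ t (just P)
  value-sn (pair c d d′) = pair c d d′
  value-sn (inj i c d)   = inj i c d
  value-sn (ν c d)       = ν c d

  weaken-value : ∀ {t P Q} → Value Γ t P → Value (Q ∷ Γ) (weaken t) P
  weaken-value (pair c d d′) = pair c (weaken-sn d) (weaken-sn d′)
  weaken-value (inj i c d)   = inj i c (weaken-sn d)
  weaken-value (ν c d)       = ν c (weaken-sn d)

  mutual
    -- The four lemmas recurse on `A` first and on the derivations of the two sides afterwards. This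
    -- one passes to `abs-sn` at the same `A` with freshly built derivations, which is harmless
    -- because `abs-values-sn` has descended to an immediate subformula before calling it.
    bowtie-sn : ∀ A {p p′ t s Q} → rank A < k → Opp p p′ → Sn Γ t (just (A ^ classical p)) →
                Sn Γ s (just (A ^ classical p′)) → Sn Γ (bowtie (classical p) Q t s) nothing
    bowtie-sn A r +- d d′ = abs-sn A (<⇒≤ r) +- (app-sn r +- d d′) (app-sn r -+ d′ d)
    bowtie-sn A r -+ d d′ = abs-sn A (<⇒≤ r) -+ (app-sn r -+ d d′) (app-sn r +- d′ d)

    abs-sn : ∀ A {p p′ t s Q} → rank A ≤ k → Opp p p′ → Sn Γ t (just (A ^ strong p)) →
             Sn Γ s (just (A ^ strong p′)) → Sn Γ (t ▶◀[ Q ] s) nothing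
    abs-sn A r o (ne d) d′               = absˡ o d d′
    abs-sn A r o (exp h d) d′            = exp (frame (absˡ _ _) h) (abs-sn A r o d d′)
    abs-sn A r o (split c S d d₁ d₂) d′  =
      split c (there (absˡ _ _) S) d
        (abs-sn A r o d₁ (weaken-sn d′)) (abs-sn A r o d₂ (weaken-sn d′))
    abs-sn A r o (pair c d₁ d₂) d′       = abs-value-sn A r o (pair c d₁ d₂) d′
    abs-sn A r o (inj i c d) d′          = abs-value-sn A r o (inj i c d) d′
    abs-sn A r o (ν c d) d′              = abs-value-sn A r o (ν c d) d′

    abs-value-sn : ∀ A {p p′ t s Q} → rank A ≤ k → Opp p p′ → Value Γ t (A ^ strong p) →
                   Sn Γ s (just (A ^ strong p′)) → Sn Γ (t ▶◀[ Q ] s) nothing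
    abs-value-sn A r o v (ne d)              = absʳ o (value-sn v) d
    abs-value-sn A r o v (exp h d)           = exp (frame (absʳ _ _) h) (abs-value-sn A r o v d)
    abs-value-sn A r o v (split c S d d₁ d₂) =
      split c (there (absʳ _ _) S) d
        (abs-value-sn A r o (weaken-value v) d₁) (abs-value-sn A r o (weaken-value v) d₂)
    abs-value-sn A r o v (pair c d₁ d₂)      = abs-values-sn A r o v (pair c d₁ d₂)
    abs-value-sn A r o v (inj i c d)         = abs-values-sn A r o v (inj i c d)
    abs-value-sn A r o v (ν c d)             = abs-values-sn A r o v (ν c d)

    abs-values-sn : ∀ A {p p′ t s Q} → rank A ≤ k → Opp p p′ → Value Γ t (A ^ strong p) →
                    Value Γ s (A ^ strong p′) → Sn Γ (t ▶◀[ Q ] s) nothing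
    abs-values-sn (A ∧ B) r +- (pair ∧⁺ d₁ d₂) (inj zero ∧⁻ d) =
      exp (▶◀-pair zero d₁ d₂) (bowtie-sn A (small-l A B r) +- d₁ d)
    abs-values-sn (A ∧ B) r +- (pair ∧⁺ d₁ d₂) (inj (suc zero) ∧⁻ d) =
      exp (▶◀-pair (suc zero) d₁ d₂) (bowtie-sn B (small-r A B r) +- d₂ d)
    abs-values-sn (A ∧ B) r -+ (inj zero ∧⁻ d) (pair ∧⁺ d₁ d₂) =
      exp (▶◀-inj zero d₁ d₂) (bowtie-sn A (small-l A B r) -+ d d₁)
    abs-values-sn (A ∧ B) r -+ (inj (suc zero) ∧⁻ d) (pair ∧⁺ d₁ d₂) =
      exp (▶◀-inj (suc zero) d₁ d₂) (bowtie-sn B (small-r A B r) -+ d d₂)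
    abs-values-sn (A ∨ B) r -+ (pair ∨⁻ d₁ d₂) (inj zero ∨⁺ d) =
      exp (▶◀-pair zero d₁ d₂) (bowtie-sn A (small-l A B r) -+ d₁ d)
    abs-values-sn (A ∨ B) r -+ (pair ∨⁻ d₁ d₂) (inj (suc zero) ∨⁺ d) =
      exp (▶◀-pair (suc zero) d₁ d₂) (bowtie-sn B (small-r A B r) -+ d₂ d)
    abs-values-sn (A ∨ B) r +- (inj zero ∨⁺ d) (pair ∨⁻ d₁ d₂) =
      exp (▶◀-inj zero d₁ d₂) (bowtie-sn A (small-l A B r) +- d d₁)
    abs-values-sn (A ∨ B) r +- (inj (suc zero) ∨⁺ d) (pair ∨⁻ d₁ d₂) =
      exp (▶◀-inj (suc zero) d₁ d₂) (bowtie-sn B (small-r A B r) +- d d₂)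
    abs-values-sn (neg A) r +- (ν ¬⁺ d) (ν ¬⁻ d′) = exp ▶◀-ν (bowtie-sn A r -+ d d′)
    abs-values-sn (neg A) r -+ (ν ¬⁻ d) (ν ¬⁺ d′) = exp ▶◀-ν (bowtie-sn A r +- d d′)

  inj-sn : ∀ {p P Q R w t₁ t₂ J} i → Sum p R P Q → Small k R →
           Sn Γ w (just (pick i P Q)) → Sn (P ∷ Γ) t₁ J → Sn (Q ∷ Γ) t₂ J →
           Sn Γ (pick i t₁ t₂ [ w ]) J
  inj-sn zero       (∨⁺ {A} {B}) r d d₁ d₂ = sub (small-l A B r) d₁ d
  inj-sn zero       (∧⁻ {A} {B}) r d d₁ d₂ = sub (small-l A B r) d₁ d
  inj-sn (suc zero) (∨⁺ {A} {B}) r d d₁ d₂ = sub (small-r A B r) d₂ d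
  inj-sn (suc zero) (∧⁻ {A} {B}) r d d₁ d₂ = sub (small-r A B r) d₂ d

  ext-suc-sn : ∀ {P Q t J} → Sn (P ∷ Γ) t J → Sn (P ∷ Q ∷ Γ) (rename (ext suc) t) J
  ext-suc-sn = rename-sn (ext-Renaming (λ _ → refl))

  -- Induction on the derivation for the scrutinee, with the surrounding stack kept in the `Split`:
  -- a neutral scrutinee gives the rule `split`, a nested distinction is commuted outwards, and an
  -- injection calls for a substitution at rank below `k`.
  case-sn : ∀ {p P Q R t v t₁ t₂ J} → Sum p R P Q → Small k R → Split p P Q t v t₁ t₂ →
            Sn Γ v (just R) → Sn (P ∷ Γ) t₁ J → Sn (Q ∷ Γ) t₂ J → Sn Γ t J
  case-sn c r S (ne d) d₁ d₂ = split c S d d₁ d₂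
  case-sn c r S (exp h d) d₁ d₂ with split-step S h
  ... | _ , h′ , S′ = exp h′ (case-sn c r S′ d d₁ d₂)
  case-sn c r S (split c′ S′ d e₁ e₂) d₁ d₂ with split-split S S′
  ... | _ , _ , S₀ , S₁ , S₂ =
    split c′ S₀ d (case-sn c r S₁ e₁ (ext-suc-sn d₁) (ext-suc-sn d₂))
                  (case-sn c r S₂ e₂ (ext-suc-sn d₁) (ext-suc-sn d₂))
  case-sn ∨⁺ r S (inj i ∨⁺ d) d₁ d₂ = exp (δ-inj i S d d₁ d₂) (inj-sn i ∨⁺ r d d₁ d₂)
  case-sn ∧⁻ r S (inj i ∧⁻ d) d₁ d₂ = exp (δ-inj i S d d₁ d₂) (inj-sn i ∧⁻ r d d₁ d₂)
  case-sn ∨⁺ r S (pair () _ _) d₁ d₂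
  case-sn ∧⁻ r S (pair () _ _) d₁ d₂
  case-sn ∨⁺ r S (ν () _) d₁ d₂
  case-sn ∧⁻ r S (ν () _) d₁ d₂

-- Substitution lemma for a fixed proposition, relative to a set of substituted terms

opp-functional : ∀ {p q q′} → Opp p q → Opp p q′ → q ≡ q′
opp-functional +- +- = refl
opp-functional -+ -+ = refl

opp-sym : ∀ {p q} → Opp p q → Opp q p
opp-sym +- = -+
opp-sym -+ = +-

opp-irrefl : ∀ {p} → ¬ Opp p p
opp-irrefl ()

TermPred : Set₁
TermPred = ∀ {n} → Ctx n → Term n → Set

-- The conclusion of the substitution lemma: `Sn`, strengthened by a reducibility clause at the
-- single type `A ^ classical q` and vacuously elsewhere. The clause quantifies over renamings, as
-- in a Kripke model, so that it can be used under binders.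
record Appl (A : Pure) (q : Sign) (X : TermPred)
            {n} (Γ : Ctx n) (t : Term n) (J : Maybe Type) : Set where
  constructor _,_
  field
    sn    : Sn Γ t J
    apply : J ≡ just (A ^ classical q) →
            ∀ {m} {Δ : Ctx m} {ρ} → Renaming Γ Δ ρ → ∀ {s} → X Δ s →
            Sn Δ (rename ρ t •⟨ q ⟩ s) (just (A ^ strong q))
open Appl

-- The set `X` has type `A ^ classical q′`, and the strengthened conclusion concerns the opposite
-- sign `q`. The argument of a substituted term is itself a result of substitution, hence `app-X`
-- may assume that it satisfies `Appl`.
module Substitution
  {k : ℕ} (sub : SubstClosed k) (A : Pure) (rA : rank A ≤ k) {q q′ : Sign} (o : Opp q q′)
  (X : TermPred)
  (rename-X : ∀ {m n} {Γ : Ctx m} {Δ : Ctx n} {ρ} → Renaming Γ Δ ρ →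
              ∀ {t} → X Γ t → X Δ (rename ρ t))
  (X⇒sn : ∀ {n} {Γ : Ctx n} {t} → X Γ t → Sn Γ t (just (A ^ classical q′)))
  (app-X : ∀ {n} {Γ : Ctx n} {t s} → X Γ t → Appl A q X Γ s (just (A ^ classical q)) →
           Sn Γ (t •⟨ q′ ⟩ s) (just (A ^ strong q′)))
  where

  -- The possible fates of a neutral term under substitution: it stays neutral, its type falls
  -- within reach of the induction hypothesis, or it is a substituted term. The only elimination
  -- that fits a `special` term is application, and it leads to `small`.
  data Val {n} (Γ : Ctx n) (t : Term n) : Type → Set where
    ne      : ∀ {P} → Ne Γ t P → Val Γ t P
    small   : ∀ {P} → Small k P → Sn Γ t (just P) → Val Γ t P
    special : X Γ t → Val Γ t (A ^ classical q′)

  Vals : Ctx n → (Fin m → Term n) → Ctx m → Set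
  Vals Δ σ Γ = ∀ x → Val Δ (σ x) (lookup Γ x)

  rename-val : ∀ {ρ} → Renaming Γ Δ ρ → ∀ {t P} → Val Γ t P → Val Δ (rename ρ t) P
  rename-val ρ∶ (ne d)      = ne (rename-ne ρ∶ d)
  rename-val ρ∶ (small r d) = small r (rename-sn ρ∶ d)
  rename-val ρ∶ (special x) = special (rename-X ρ∶ x)

  exts-vals : ∀ {σ P} → Vals Δ σ Γ → Vals (P ∷ Δ) (exts σ) (P ∷ Γ)
  exts-vals σ∶ zero    = ne (var refl)
  exts-vals σ∶ (suc x) = rename-val (λ _ → refl) (σ∶ x)

  A≢ : ¬ just (A ^ classical q′) ≡ just (A ^ classical q)
  A≢ refl = opp-irrefl o

  appl-val : ∀ {t P} → Val Γ t P → Appl A q X Γ t (just P)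
  appl-val (ne d)      = ne d , λ { refl ρ∶ x → ne (app o (rename-ne ρ∶ d) (X⇒sn x)) }
  appl-val (small r d) = d , λ { refl ρ∶ x → app-sn sub r o (rename-sn ρ∶ d) (X⇒sn x) }
  appl-val (special x) = X⇒sn x , λ eq → ⊥-elim (A≢ eq)

  appl-exp : ∀ {t t′ J} → Γ ⊢ t ⇒ t′ → Appl A q X Γ t′ J → Appl A q X Γ t J
  appl-exp r (d , f) = exp r d , λ eq ρ∶ x → exp (frame (app _ _) (rename-⇒ ρ∶ r)) (f eq ρ∶ x)

  case-val : ∀ {p P Q R t v t₁ t₂ J} → Sum p R P Q → Split p P Q t v t₁ t₂ →
             Val Γ v R → Sn (P ∷ Γ) t₁ J → Sn (Q ∷ Γ) t₂ J → Sn Γ t J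
  case-val c S (ne d)      d₁ d₂ = split c S d d₁ d₂
  case-val c S (small r d) d₁ d₂ = case-sn sub c r S d d₁ d₂
  case-val () S (special _) d₁ d₂

  appl-case : ∀ {p P Q R t v t₁ t₂ J} → Sum p R P Q → Split p P Q t v t₁ t₂ →
              Val Γ v R → Appl A q X (P ∷ Γ) t₁ J → Appl A q X (Q ∷ Γ) t₂ J → Appl A q X Γ t J
  appl-case c S v (d₁ , f₁) (d₂ , f₂) =
    case-val c S v d₁ d₂ ,
    -- The pending application becomes one more frame on the stack, so it is carried out in each
    -- branch.
    λ eq ρ∶ x → case-val c (there (app _ _) (rename-split _ S)) (rename-val ρ∶ v)
      (f₁ eq (ext-Renaming ρ∶) (rename-X (λ _ → refl) x))
      (f₂ eq (ext-Renaming ρ∶) (rename-X (λ _ → refl) x))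

  app-val : ∀ {B p p′ t s} → Opp p p′ → Val Γ t (B ^ classical p) →
            Appl A q X Γ s (just (B ^ classical p′)) → Val Γ (t •⟨ p ⟩ s) (B ^ strong p)
  app-val o′ (ne d)      a = ne (app o′ d (sn a))
  app-val o′ (small r d) a = small (<⇒≤ r) (app-sn sub r o′ d (sn a))
  app-val o′ (special x) a with opp-functional o′ (opp-sym o)
  -- The result has type `A ^ strong q′`, which is small because `rank A` is at most `k`.
  ... | refl = small rA (app-X x a)

  proj-val : ∀ {p P Q R t} i → Prod p R P Q → Val Γ t R → Val Γ (π p i t) (pick i P Q)
  proj-val i c  (ne d)      = ne (proj i c d)
  proj-val i c  (small r d) = small (small-prod i c r) (proj-sn i c d)
  proj-val i () (special _)

  unν-val : ∀ {p P R t} → Neg p R P → Val Γ t R → Val Γ (μ p t) P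
  unν-val c  (ne d)      = ne (unν c d)
  unν-val c  (small r d) = small (small-neg c r) (unν-sn c d)
  unν-val () (special _)

  absˡ-val : ∀ {B p p′ t s Q} → Opp p p′ → Val Γ t (B ^ strong p) →
             Sn Γ s (just (B ^ strong p′)) → Sn Γ (t ▶◀[ Q ] s) nothing
  absˡ-val o′ (ne d)      d′ = absˡ o′ d d′
  absˡ-val o′ (small r d) d′ = abs-sn sub _ r o′ d d′

  absʳ-val : ∀ {B p p′ t s Q} → Opp p p′ → Sn Γ t (just (B ^ strong p)) →
             Val Γ s (B ^ strong p′) → Sn Γ (t ▶◀[ Q ] s) nothing
  absʳ-val o′ d (ne d′)      = absʳ o′ d d′
  absʳ-val o′ d (small r d′) = abs-sn sub _ r o′ d d′

  mutual
    -- Structural induction on the derivation. The substitution is simultaneous and arbitrary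
    -- because the case of `IC` also has to instantiate the variable bound there.
    subst-sn : ∀ {σ} → Vals Δ σ Γ → ∀ {t J} → Sn Γ t J → Appl A q X Δ (subst σ t) J
    subst-sn σ∶ (ne d)         = appl-val (subst-ne σ∶ d)
    subst-sn σ∶ (exp r d)      = appl-exp (subst-⇒ σ∶ r) (subst-sn σ∶ d)
    subst-sn σ∶ (split c S d d₁ d₂) =
      appl-case c (subst-split _ S) (subst-ne σ∶ d)
        (subst-sn (exts-vals σ∶) d₁) (subst-sn (exts-vals σ∶) d₂)
    subst-sn σ∶ (pair c d d′)  =
      pair c (sn (subst-sn σ∶ d)) (sn (subst-sn σ∶ d′)) , λ { refl → case c of λ () }
    subst-sn σ∶ (inj i c d)    = inj i c (sn (subst-sn σ∶ d)) , λ { refl → case c of λ () }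
    subst-sn σ∶ (ν c d)        = ν c (sn (subst-sn σ∶ d)) , λ { refl → case c of λ () }
    subst-sn {σ = σ} σ∶ (ic {t = b} o′ d) =
      ic o′ (sn (subst-sn (exts-vals σ∶) d)) ,
      -- After the contraction, the body under `σ`, renamed and instantiated with `s`, is the body
      -- under `s ◂ (rename ρ ∘ σ)`. The induction hypothesis for the premise `d` applies to that
      -- substitution, with `s` entering as a `special` value.
      λ { refl {ρ = ρ} ρ∶ {s} x → exp (β (X⇒sn x))
            (transport (λ t → Sn _ t _)
              (sym (trans (cong _[ s ] (rename-subst (ext-exts (λ _ → refl)) b))
                          (exts-[] (rename ρ ∘ σ) s b)))
              (sn (subst-sn (λ { zero    → transport (λ p → Val _ s (A ^ classical p))
                                             (opp-functional o o′) (special x)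
                               ; (suc y) → rename-val ρ∶ (σ∶ y) }) d))) }
    subst-sn σ∶ (absˡ o′ d d′) = absˡ-val o′ (subst-ne σ∶ d) (sn (subst-sn σ∶ d′)) , λ ()
    subst-sn σ∶ (absʳ o′ d d′) = absʳ-val o′ (sn (subst-sn σ∶ d)) (subst-ne σ∶ d′) , λ ()

    subst-ne : ∀ {σ} → Vals Δ σ Γ → ∀ {t P} → Ne Γ t P → Val Δ (subst σ t) P
    subst-ne σ∶ (var refl)    = σ∶ _
    subst-ne σ∶ (app o′ d d′) = app-val o′ (subst-ne σ∶ d) (subst-sn σ∶ d′)
    subst-ne σ∶ (proj i c d)  = proj-val i c (subst-ne σ∶ d)
    subst-ne σ∶ (unν c d)     = unν-val c (subst-ne σ∶ d)
    subst-ne σ∶ (abs d)       = ne (abs (sn (subst-sn σ∶ d)))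

    subst-⇒ : ∀ {σ} → Vals Δ σ Γ → ∀ {t t′} → Γ ⊢ t ⇒ t′ → Δ ⊢ subst σ t ⇒ subst σ t′
    subst-⇒ {σ = σ} σ∶ (β {t = t} {s} d) =
      reduct (subst-[] σ t s) (β (sn (subst-sn σ∶ d)))
    subst-⇒ {σ = σ} σ∶ (π-pair i d d′) =
      reduct (pick-∘ (subst σ) i) (π-pair i (sn (subst-sn σ∶ d)) (sn (subst-sn σ∶ d′)))
    subst-⇒ σ∶ μ-ν = μ-ν
    subst-⇒ {σ = σ} σ∶ (δ-inj i S d d₁ d₂) =
      reduct (subst-pick-[] σ i)
        (δ-inj i (subst-split σ S) (sn (subst-sn σ∶ d))
          (sn (subst-sn (exts-vals σ∶) d₁)) (sn (subst-sn (exts-vals σ∶) d₂)))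
    subst-⇒ {σ = σ} σ∶ (▶◀-pair {p} i d d′) =
      reduct (subst-bowtieˡ σ (classical p) i)
        (▶◀-pair i (sn (subst-sn σ∶ d)) (sn (subst-sn σ∶ d′)))
    subst-⇒ {σ = σ} σ∶ (▶◀-inj {p} i d d′) =
      reduct (subst-bowtieʳ σ (classical p) i)
        (▶◀-inj i (sn (subst-sn σ∶ d)) (sn (subst-sn σ∶ d′)))
    subst-⇒ {σ = σ} σ∶ (▶◀-ν {p}) =
      reduct (subst-bowtie σ (classical (opposite p))) ▶◀-ν
    subst-⇒ {σ = σ} σ∶ (frame F r) =
      transport₂ (_ ⊢_⇒_) (sym (subst-plug σ F)) (sym (subst-plug σ F))
        (frame (substF σ F) (subst-⇒ σ∶ r))

-- Resolving the mutual dependence of `A ^ ⊕` and `A ^ ⊖`; every typed term is in `Sn`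

rename-id : (t : Term n) → rename id t ≡ t
rename-id t = trans (sym (subst-var (λ _ → refl) (rename id t)))
                    (trans (subst-rename (λ _ → refl) t) (subst-var (λ _ → refl) t))

module Level {k : ℕ} (sub : SubstClosed k) (A : Pure) (rA : rank A ≤ k) where

  Sn⊖ Appl⊕ : TermPred
  Sn⊖ Γ t   = Sn Γ t (just (A ^ ⊖))
  Appl⊕ Γ t = Appl A + Sn⊖ Γ t (just (A ^ ⊕))

  apply-here : ∀ {q} {X : TermPred} {Γ : Ctx n} {t s} → Appl A q X Γ t (just (A ^ classical q)) →
               X Γ s → Sn Γ (t •⟨ q ⟩ s) (just (A ^ strong q))
  apply-here {t = t} a x =
    transport (λ t → Sn _ (t •⟨ _ ⟩ _) _) (rename-id t) (apply a refl (λ _ → refl) x)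

  rename-appl : ∀ {q} {X : TermPred} {Γ : Ctx m} {Δ : Ctx n} {ρ} → Renaming Γ Δ ρ →
                ∀ {t J} → Appl A q X Γ t J → Appl A q X Δ (rename ρ t) J
  rename-appl ρ∶ {t} (d , f) =
    rename-sn ρ∶ d ,
    λ eq ρ′∶ x → transport (λ t → Sn _ (t •⟨ _ ⟩ _) _) (sym (rename-∘ (λ _ → refl) t))
                   (f eq (λ y → trans (ρ′∶ _) (ρ∶ y)) x)

  -- First run, with `X` the terms of type `A ^ ⊕` that accept every `Sn` argument: here `app-X` is
  -- the defining property of `X`.
  module ⊕-values = Substitution sub A rA -+ Appl⊕
    (λ ρ∶ → rename-appl {X = Sn⊖} ρ∶) sn (λ a a′ → apply-here {X = Sn⊖} a (sn a′))

  -- The identity substitution turns the substitution lemma into a statement about `t` itself; what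
  -- is gained is the applicability clause.
  appl⊖ : ∀ {Γ : Ctx n} {t} → Sn⊖ Γ t → Appl A - Appl⊕ Γ t (just (A ^ ⊖))
  appl⊖ {t = t} d =
    transport (λ t → Appl A - Appl⊕ _ t _) (subst-var (λ _ → refl) t)
      (⊕-values.subst-sn (λ x → ⊕-values.ne (var refl)) d)

  -- Second run, with `X` all `Sn` terms of type `A ^ ⊖`: such a term meets arguments in `Appl⊕`,
  -- and `appl⊖` from the first run allows the application.
  module ⊖-values = Substitution sub A rA +- Sn⊖
    (λ ρ∶ → rename-sn ρ∶) id (λ d a → apply-here {X = Appl⊕} (appl⊖ d) a)

  appl⊕ : ∀ {Γ : Ctx n} {t} → Sn Γ t (just (A ^ ⊕)) → Appl⊕ Γ t
  appl⊕ {t = t} d =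
    transport (λ t → Appl A + Sn⊖ _ t _) (subst-var (λ _ → refl) t)
      (⊖-values.subst-sn (λ x → ⊖-values.ne (var refl)) d)

  []-sn : ∀ {Γ : Ctx n} p {b s J} → Sn ((A ^ classical p) ∷ Γ) b J →
          Sn Γ s (just (A ^ classical p)) → Sn Γ (b [ s ]) J
  []-sn + d d′ = sn (⊕-values.subst-sn (λ { zero    → ⊕-values.special (appl⊕ d′)
                                          ; (suc x) → ⊕-values.ne (var refl) }) d)
  []-sn - d d′ = sn (⊖-values.subst-sn (λ { zero    → ⊖-values.special d′
                                          ; (suc x) → ⊖-values.ne (var refl) }) d)

-- Induction on `k`. A rank below `suc k` is at most `k`, the bound under which `Level` extends
-- closure below `k` to `A`.
subst-closed : ∀ k → SubstClosed k
subst-closed zero    ()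
subst-closed (suc k) (s≤s r) = Level.[]-sn (subst-closed k) _ r _

-- Each typing rule has an admissible counterpart for `Sn`. For absurdities and case distinctions
-- the rank of the eliminated proposition serves as `k`, since only its components are substituted
-- for; application substitutes at `A` itself and takes one more.
typed-sn : ∀ {Γ : Ctx n} {t P} → Γ ⊢ t ∶ P → Sn Γ t (just P)
typed-sn (ax eq) = ne (var eq)
typed-sn (abs (strong A +) d d′) =
  ne (abs (abs-sn (subst-closed (rank A)) A ≤-refl +- (typed-sn d) (typed-sn d′)))
typed-sn (abs (strong A -) d d′) =
  ne (abs (abs-sn (subst-closed (rank A)) A ≤-refl -+ (typed-sn d) (typed-sn d′)))
typed-sn (I∧⁺ d d′)       = pair ∧⁺ (typed-sn d) (typed-sn d′)
typed-sn (I∨⁻ d d′)       = pair ∨⁻ (typed-sn d) (typed-sn d′)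
-- The index is split because the typing rules have `pick i` inside `_^_` and `Sn` has it outside;
-- the two agree by computation only at a concrete index.
typed-sn (E∧⁺ zero d)       = proj-sn zero ∧⁺ (typed-sn d)
typed-sn (E∧⁺ (suc zero) d) = proj-sn (suc zero) ∧⁺ (typed-sn d)
typed-sn (E∨⁻ zero d)       = proj-sn zero ∨⁻ (typed-sn d)
typed-sn (E∨⁻ (suc zero) d) = proj-sn (suc zero) ∨⁻ (typed-sn d)
typed-sn (I∨⁺ zero d)       = inj zero ∨⁺ (typed-sn d)
typed-sn (I∨⁺ (suc zero) d) = inj (suc zero) ∨⁺ (typed-sn d)
typed-sn (I∧⁻ zero d)       = inj zero ∧⁻ (typed-sn d)
typed-sn (I∧⁻ (suc zero) d) = inj (suc zero) ∧⁻ (typed-sn d)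
typed-sn (E∨⁺ d d₁ d₂)    =
  case-sn (subst-closed _) ∨⁺ ≤-refl here (typed-sn d) (typed-sn d₁) (typed-sn d₂)
typed-sn (E∧⁻ d d₁ d₂)    =
  case-sn (subst-closed _) ∧⁻ ≤-refl here (typed-sn d) (typed-sn d₁) (typed-sn d₂)
typed-sn (I¬⁺ d)          = ν ¬⁺ (typed-sn d)
typed-sn (I¬⁻ d)          = ν ¬⁻ (typed-sn d)
typed-sn (E¬⁺ d)          = unν-sn ¬⁺ (typed-sn d)
typed-sn (E¬⁻ d)          = unν-sn ¬⁻ (typed-sn d)
typed-sn (IC⁺ d)          = ic +- (typed-sn d)
typed-sn (IC⁻ d)          = ic -+ (typed-sn d)
typed-sn (EC⁺ d d′)       = app-sn (subst-closed _) (n<1+n _) +- (typed-sn d) (typed-sn d′)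
typed-sn (EC⁻ d d′)       = app-sn (subst-closed _) (n<1+n _) -+ (typed-sn d) (typed-sn d′)

-- Reduction and substitution

infix 3 _⟶*_

_⟶*_ : Term n → Term n → Set
_⟶*_ = Star _⟶_

prk⟶ : {t u : Term n} → t ↦ u → t ⟶ u
prk⟶ r = root (prk r)

contractum : {t u u′ : Term n} → u ≡ u′ → t ↦ u′ → t ↦ u
contractum refl r = r

subst-↦ : (σ : Fin m → Term n) {t u : Term m} → t ↦ u → subst σ t ↦ subst σ u
subst-↦ σ (π-pair p i) = contractum (pick-∘ (subst σ) i) (π-pair p i)
subst-↦ σ (δ-inj p i) = contractum (subst-pick-[] σ i) (δ-inj p i)
subst-↦ σ (μ-ν p) = μ-ν p
subst-↦ σ (IC-• p {t = t} {s}) = contractum (subst-[] σ t s) (IC-• p)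
subst-↦ σ (▶◀-pair p i) = contractum (subst-bowtieˡ σ (classical p) i) (▶◀-pair p i)
subst-↦ σ (▶◀-inj p i) = contractum (subst-bowtieʳ σ (classical p) i) (▶◀-inj p i)
subst-↦ σ (▶◀-ν p) = contractum (subst-bowtie σ (classical (opposite p))) (▶◀-ν p)

subst-⟶ : (σ : Fin m → Term n) {t u : Term m} → t ⟶ u → subst σ t ⟶ subst σ u
subst-⟶ σ (root (prk r)) = prk⟶ (subst-↦ σ r)
subst-⟶ σ (root (η p {P} {t})) =
  transport (λ s → IC p P (s •⟨ p ⟩ var zero) ⟶ subst σ t) (sym (subst-weaken σ t)) (root (η p))
subst-⟶ σ (ξ-▶◀₁ r)  = ξ-▶◀₁ (subst-⟶ σ r)
subst-⟶ σ (ξ-▶◀₂ r)  = ξ-▶◀₂ (subst-⟶ σ r)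
subst-⟶ σ (ξ-pair₁ r) = ξ-pair₁ (subst-⟶ σ r)
subst-⟶ σ (ξ-pair₂ r) = ξ-pair₂ (subst-⟶ σ r)
subst-⟶ σ (ξ-π r)    = ξ-π (subst-⟶ σ r)
subst-⟶ σ (ξ-inj r)  = ξ-inj (subst-⟶ σ r)
subst-⟶ σ (ξ-δ₀ r)   = ξ-δ₀ (subst-⟶ σ r)
subst-⟶ σ (ξ-δ₁ r)   = ξ-δ₁ (subst-⟶ (exts σ) r)
subst-⟶ σ (ξ-δ₂ r)   = ξ-δ₂ (subst-⟶ (exts σ) r)
subst-⟶ σ (ξ-ν r)    = ξ-ν (subst-⟶ σ r)
subst-⟶ σ (ξ-μ r)    = ξ-μ (subst-⟶ σ r)
subst-⟶ σ (ξ-IC r)   = ξ-IC (subst-⟶ (exts σ) r)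
subst-⟶ σ (ξ-•₁ r)   = ξ-•₁ (subst-⟶ σ r)
subst-⟶ σ (ξ-•₂ r)   = ξ-•₂ (subst-⟶ σ r)

rename-as-subst : (ρ : Fin m → Fin n) (t : Term m) → rename ρ t ≡ subst (var ∘ ρ) t
rename-as-subst ρ t = trans (sym (subst-var (λ _ → refl) (rename ρ t))) (subst-rename (λ _ → refl) t)

rename-⟶ : (ρ : Fin m → Fin n) {t u : Term m} → t ⟶ u → rename ρ t ⟶ rename ρ u
rename-⟶ ρ {t} {u} r =
  transport₂ _⟶_ (sym (rename-as-subst ρ t)) (sym (rename-as-subst ρ u)) (subst-⟶ (var ∘ ρ) r)

infix 3 _⟶s_

_⟶s_ : (σ τ : Fin m → Term n) → Set
σ ⟶s τ = ∀ x → σ x ⟶* τ x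

exts-⟶s : {σ τ : Fin m → Term n} → σ ⟶s τ → exts σ ⟶s exts τ
exts-⟶s rs zero    = ε
exts-⟶s rs (suc x) = gmap weaken (rename-⟶ suc) (rs x)

⟶*-▶◀ : ∀ {Q} {t t′ s s′ : Term n} → t ⟶* t′ → s ⟶* s′ → t ▶◀[ Q ] s ⟶* t′ ▶◀[ Q ] s′
⟶*-▶◀ rs rs′ = gmap (_▶◀[ _ ] _) ξ-▶◀₁ rs ◅◅ gmap (_ ▶◀[ _ ]_) ξ-▶◀₂ rs′

⟶*-• : ∀ {p} {t t′ s s′ : Term n} → t ⟶* t′ → s ⟶* s′ → t •⟨ p ⟩ s ⟶* t′ •⟨ p ⟩ s′
⟶*-• rs rs′ = gmap (_•⟨ _ ⟩ _) ξ-•₁ rs ◅◅ gmap (_ •⟨ _ ⟩_) ξ-•₂ rs′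

⟶*-bowtie : ∀ M {Q} {t t′ s s′ : Term n} → t ⟶* t′ → s ⟶* s′ → bowtie M Q t s ⟶* bowtie M Q t′ s′
⟶*-bowtie (strong _) rs rs′ = ⟶*-▶◀ rs rs′
⟶*-bowtie ⊕          rs rs′ = ⟶*-▶◀ (⟶*-• rs rs′) (⟶*-• rs′ rs)
⟶*-bowtie ⊖          rs rs′ = ⟶*-▶◀ (⟶*-• rs rs′) (⟶*-• rs′ rs)

subst-⟶* : {σ τ : Fin m → Term n} → σ ⟶s τ → ∀ t → subst σ t ⟶* subst τ t
subst-⟶* rs (var x)         = rs x
subst-⟶* rs (t ▶◀[ P ] s)   = ⟶*-▶◀ (subst-⟶* rs t) (subst-⟶* rs s)
subst-⟶* rs (⟨ t , s ⟩^ p)  =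
  gmap (λ t → ⟨ t , _ ⟩^ p) ξ-pair₁ (subst-⟶* rs t) ◅◅ gmap (λ s → ⟨ _ , s ⟩^ p) ξ-pair₂ (subst-⟶* rs s)
subst-⟶* rs (π p i t)       = gmap (π p i) ξ-π (subst-⟶* rs t)
subst-⟶* rs (inj p i t)     = gmap (inj p i) ξ-inj (subst-⟶* rs t)
subst-⟶* rs (δ p t P s Q u) =
  gmap (λ t → δ p t P _ Q _) ξ-δ₀ (subst-⟶* rs t) ◅◅
  gmap (λ s → δ p _ P s Q _) ξ-δ₁ (subst-⟶* (exts-⟶s rs) s) ◅◅
  gmap (λ u → δ p _ P _ Q u) ξ-δ₂ (subst-⟶* (exts-⟶s rs) u)
subst-⟶* rs (ν p t)         = gmap (ν p) ξ-ν (subst-⟶* rs t)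
subst-⟶* rs (μ p t)         = gmap (μ p) ξ-μ (subst-⟶* rs t)
subst-⟶* rs (IC p P t)      = gmap (IC p P) ξ-IC (subst-⟶* (exts-⟶s rs) t)
subst-⟶* rs (t •⟨ p ⟩ s)    = ⟶*-• (subst-⟶* rs t) (subst-⟶* rs s)

[]-⟶* : (b : Term (suc n)) {s s′ : Term n} → s ⟶ s′ → b [ s ] ⟶* b [ s′ ]
[]-⟶* b r = subst-⟶* (λ { zero → r ◅ ε ; (suc x) → ε }) b

pick-⟶*ˡ : ∀ i {t₁ t₁′ t₂ : Term n} → t₁ ⟶ t₁′ → pick i t₁ t₂ ⟶* pick i t₁′ t₂
pick-⟶*ˡ zero       r = r ◅ ε
pick-⟶*ˡ (suc zero) r = ε

pick-⟶*ʳ : ∀ i {t₁ t₂ t₂′ : Term n} → t₂ ⟶ t₂′ → pick i t₁ t₂ ⟶* pick i t₁ t₂′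
pick-⟶*ʳ zero       r = ε
pick-⟶*ʳ (suc zero) r = r ◅ ε

[]-⟶*ˡ : {b b′ : Term (suc n)} {s : Term n} → b ⟶* b′ → b [ s ] ⟶* b′ [ s ]
[]-⟶*ˡ = gmap (_[ _ ]) (subst-⟶ _)

↦-deterministic : {t u u′ : Term n} → t ↦ u → t ↦ u′ → u ≡ u′
↦-deterministic (π-pair p i)   (π-pair p i)   = refl
↦-deterministic (δ-inj p i)    (δ-inj p i)    = refl
↦-deterministic (μ-ν p)        (μ-ν p)        = refl
↦-deterministic (IC-• p)       (IC-• p)       = refl
↦-deterministic (▶◀-pair p i)  (▶◀-pair p i)  = refl
↦-deterministic (▶◀-inj p i)   (▶◀-inj p i)   = refl
↦-deterministic (▶◀-ν p)       (▶◀-ν p)       = refl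

-- The redex patterns of the calculus do not overlap, so any other step acts inside an argument and
-- leaves the redex in place. The exception is η at the function side of `IC-•`, where both reducts
-- coincide. The contractum may need zero or several steps, as arguments are erased or copied.
↦-⟶ : {t u t′ : Term n} → t ↦ u → t ⟶ t′ → t′ ≡ u ⊎ ∃[ u′ ] (t′ ↦ u′ × u ⟶* u′)
↦-⟶ r (root (prk r′)) = inj₁ (↦-deterministic r′ r)
↦-⟶ (π-pair p i) (ξ-π (root (prk ())))
↦-⟶ (π-pair p i) (ξ-π (ξ-pair₁ r)) = inj₂ (_ , π-pair p i , pick-⟶*ˡ i r)
↦-⟶ (π-pair p i) (ξ-π (ξ-pair₂ r)) = inj₂ (_ , π-pair p i , pick-⟶*ʳ i r)
↦-⟶ (δ-inj p i) (ξ-δ₀ (root (prk ())))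
↦-⟶ (δ-inj p i {s₁ = s₁} {s₂}) (ξ-δ₀ (ξ-inj r)) = inj₂ (_ , δ-inj p i , []-⟶* (pick i s₁ s₂) r)
↦-⟶ (δ-inj p i) (ξ-δ₁ r) = inj₂ (_ , δ-inj p i , []-⟶*ˡ (pick-⟶*ˡ i r))
↦-⟶ (δ-inj p i) (ξ-δ₂ r) = inj₂ (_ , δ-inj p i , []-⟶*ˡ (pick-⟶*ʳ i r))
↦-⟶ (μ-ν p) (ξ-μ (root (prk ())))
↦-⟶ (μ-ν p) (ξ-μ (ξ-ν r)) = inj₂ (_ , μ-ν p , r ◅ ε)
↦-⟶ (IC-• p) (ξ-•₁ (root (prk ())))
↦-⟶ (IC-• p {s = s}) (ξ-•₁ (root (η .p {t = t}))) = inj₁ (cong (_•⟨ p ⟩ s) (sym (weaken-[] t s)))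
↦-⟶ (IC-• p) (ξ-•₁ (ξ-IC r)) = inj₂ (_ , IC-• p , []-⟶*ˡ (r ◅ ε))
↦-⟶ (IC-• p {t = t}) (ξ-•₂ r) = inj₂ (_ , IC-• p , []-⟶* t r)
↦-⟶ (▶◀-pair p i) (ξ-▶◀₁ (root (prk ())))
↦-⟶ (▶◀-pair p i) (ξ-▶◀₁ (ξ-pair₁ r)) = inj₂ (_ , ▶◀-pair p i , ⟶*-bowtie (classical p) (pick-⟶*ˡ i r) ε)
↦-⟶ (▶◀-pair p i) (ξ-▶◀₁ (ξ-pair₂ r)) = inj₂ (_ , ▶◀-pair p i , ⟶*-bowtie (classical p) (pick-⟶*ʳ i r) ε)
↦-⟶ (▶◀-pair p i) (ξ-▶◀₂ (root (prk ())))
↦-⟶ (▶◀-pair p i) (ξ-▶◀₂ (ξ-inj r)) = inj₂ (_ , ▶◀-pair p i , ⟶*-bowtie (classical p) ε (r ◅ ε))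
↦-⟶ (▶◀-inj p i) (ξ-▶◀₁ (root (prk ())))
↦-⟶ (▶◀-inj p i) (ξ-▶◀₁ (ξ-inj r)) = inj₂ (_ , ▶◀-inj p i , ⟶*-bowtie (classical p) (r ◅ ε) ε)
↦-⟶ (▶◀-inj p i) (ξ-▶◀₂ (root (prk ())))
↦-⟶ (▶◀-inj p i) (ξ-▶◀₂ (ξ-pair₁ r)) = inj₂ (_ , ▶◀-inj p i , ⟶*-bowtie (classical p) ε (pick-⟶*ˡ i r))
↦-⟶ (▶◀-inj p i) (ξ-▶◀₂ (ξ-pair₂ r)) = inj₂ (_ , ▶◀-inj p i , ⟶*-bowtie (classical p) ε (pick-⟶*ʳ i r))
↦-⟶ (▶◀-ν p) (ξ-▶◀₁ (root (prk ())))
↦-⟶ (▶◀-ν p) (ξ-▶◀₁ (ξ-ν r)) = inj₂ (_ , ▶◀-ν p , ⟶*-bowtie (classical (opposite p)) (r ◅ ε) ε)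
↦-⟶ (▶◀-ν p) (ξ-▶◀₂ (root (prk ())))
↦-⟶ (▶◀-ν p) (ξ-▶◀₂ (ξ-ν r)) = inj₂ (_ , ▶◀-ν p , ⟶*-bowtie (classical (opposite p)) ε (r ◅ ε))

-- Sn implies strong normalisation

SN : Term n → Set
SN = Acc (flip _⟶_)

SN-⟶* : {t u : Term n} → SN t → t ⟶* u → SN u
SN-⟶* a       ε        = a
SN-⟶* (acc f) (r ◅ rs) = SN-⟶* (f r) rs

SN-reflect : (f : Term m → Term n) → (∀ {t u} → t ⟶ u → f t ⟶ f u) → ∀ {t} → SN (f t) → SN t
SN-reflect f mono (acc g) = acc λ r → SN-reflect f mono (g (mono r))

infix 3 _⟶F_

data _⟶F_ {n} : Frame n → Frame n → Set where
  app   : ∀ {p s s′} → s ⟶ s′ → app p s ⟶F app p s′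
  case₁ : ∀ {p P s s′ Q u} → s ⟶ s′ → case p P s Q u ⟶F case p P s′ Q u
  case₂ : ∀ {p P s Q u u′} → u ⟶ u′ → case p P s Q u ⟶F case p P s Q u′
  absˡ  : ∀ {Q s s′} → s ⟶ s′ → absˡ Q s ⟶F absˡ Q s′
  absʳ  : ∀ {Q s s′} → s ⟶ s′ → absʳ Q s ⟶F absʳ Q s′

SNF : Frame n → Set
SNF = Acc (flip _⟶F_)

plug-⟶ : ∀ F {t u : Term n} → t ⟶ u → plug F t ⟶ plug F u
plug-⟶ (app _ _)        = ξ-•₁
plug-⟶ (proj _ _)       = ξ-π
plug-⟶ (unν _)          = ξ-μ
plug-⟶ (case _ _ _ _ _) = ξ-δ₀
plug-⟶ (absˡ _ _)       = ξ-▶◀₁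
plug-⟶ (absʳ _ _)       = ξ-▶◀₂

plug-⟶F : ∀ {F G} {t : Term n} → F ⟶F G → plug F t ⟶ plug G t
plug-⟶F (app r)   = ξ-•₂ r
plug-⟶F (case₁ r) = ξ-δ₁ r
plug-⟶F (case₂ r) = ξ-δ₂ r
plug-⟶F (absˡ r)  = ξ-▶◀₂ r
plug-⟶F (absʳ r)  = ξ-▶◀₁ r

weaken-⟶F : {F G : Frame n} → F ⟶F G → weakenF F ⟶F weakenF G
weaken-⟶F (app r)   = app (rename-⟶ suc r)
weaken-⟶F (case₁ r) = case₁ (rename-⟶ (ext suc) r)
weaken-⟶F (case₂ r) = case₂ (rename-⟶ (ext suc) r)
weaken-⟶F (absˡ r)  = absˡ (rename-⟶ suc r)
weaken-⟶F (absʳ r)  = absʳ (rename-⟶ suc r)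

data PlugStep (F : Frame n) (t : Term n) : Term n → Set where
  redex : ∀ {u} → plug F t ↦ u → PlugStep F t u
  inner : ∀ {t′} → t ⟶ t′ → PlugStep F t (plug F t′)
  outer : ∀ {G} → F ⟶F G → PlugStep F t (plug G t)

-- η never fires at the root here, since no frame builds an `IC`.
plug-step : ∀ F {t u : Term n} → plug F t ⟶ u → PlugStep F t u
plug-step (app _ _)        (root (prk r)) = redex r
plug-step (app _ _)        (ξ-•₁ r)       = inner r
plug-step (app _ _)        (ξ-•₂ r)       = outer (app r)
plug-step (proj _ _)       (root (prk r)) = redex r
plug-step (proj _ _)       (ξ-π r)        = inner r
plug-step (unν _)          (root (prk r)) = redex r
plug-step (unν _)          (ξ-μ r)        = inner r
plug-step (case _ _ _ _ _) (root (prk r)) = redex r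
plug-step (case _ _ _ _ _) (ξ-δ₀ r)       = inner r
plug-step (case _ _ _ _ _) (ξ-δ₁ r)       = outer (case₁ r)
plug-step (case _ _ _ _ _) (ξ-δ₂ r)       = outer (case₂ r)
plug-step (absˡ _ _)       (root (prk r)) = redex r
plug-step (absˡ _ _)       (ξ-▶◀₁ r)      = inner r
plug-step (absˡ _ _)       (ξ-▶◀₂ r)      = outer (absˡ r)
plug-step (absʳ _ _)       (root (prk r)) = redex r
plug-step (absʳ _ _)       (ξ-▶◀₁ r)      = outer (absʳ r)
plug-step (absʳ _ _)       (ξ-▶◀₂ r)      = inner r

data Intro {n} : Term n → Set where
  pair : ∀ {p t s} → Intro (⟨ t , s ⟩^ p)
  inj  : ∀ {p i t} → Intro (inj p i t)
  ν    : ∀ {p t} → Intro (ν p t)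
  ic   : ∀ {p P t} → Intro (IC p P t)

redex-intro : ∀ F {t u : Term n} → plug F t ↦ u → Intro t
redex-intro (app _ _)        (IC-• _)       = ic
redex-intro (proj _ _)       (π-pair _ _)   = pair
redex-intro (unν _)          (μ-ν _)        = ν
redex-intro (case _ _ _ _ _) (δ-inj _ _)    = inj
redex-intro (absˡ _ _)       (▶◀-pair _ _)  = pair
redex-intro (absˡ _ _)       (▶◀-inj _ _)   = inj
redex-intro (absˡ _ _)       (▶◀-ν _)       = ν
redex-intro (absʳ _ _)       (▶◀-pair _ _)  = inj
redex-intro (absʳ _ _)       (▶◀-inj _ _)   = pair
redex-intro (absʳ _ _)       (▶◀-ν _)       = ν

plug-¬intro : ∀ F {t : Term n} → ¬ Intro (plug F t)
plug-¬intro (app _ _)        ()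
plug-¬intro (proj _ _)       ()
plug-¬intro (unν _)          ()
plug-¬intro (case _ _ _ _ _) ()
plug-¬intro (absˡ _ _)       ()
plug-¬intro (absʳ _ _)       ()

-- The untyped shape behind `Ne`, loose enough to be stable under arbitrary reduction.
data Neutral {n} : Term n → Set where
  var  : ∀ {x} → Neutral (var x)
  app  : ∀ {p t s} → Neutral t → Neutral (t •⟨ p ⟩ s)
  proj : ∀ {p i t} → Neutral t → Neutral (π p i t)
  unν  : ∀ {p t} → Neutral t → Neutral (μ p t)
  abs  : ∀ {Q t s} → Neutral (t ▶◀[ Q ] s)

neutral-¬intro : {t : Term n} → Neutral t → ¬ Intro t
neutral-¬intro var      ()
neutral-¬intro (app _)  ()
neutral-¬intro (proj _) ()
neutral-¬intro (unν _)  ()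
neutral-¬intro abs      ()

bowtie-neutral : ∀ M {Q} {t s : Term n} → Neutral (bowtie M Q t s)
bowtie-neutral (strong _) = abs
bowtie-neutral ⊕          = abs
bowtie-neutral ⊖          = abs

neutral-⟶ : {t u : Term n} → Neutral t → t ⟶ u → Neutral u
neutral-⟶ var      (root (prk ()))
neutral-⟶ (app ()) (root (prk (IC-• _)))
neutral-⟶ (app e)  (ξ-•₁ r) = app (neutral-⟶ e r)
neutral-⟶ (app e)  (ξ-•₂ r) = app e
neutral-⟶ (proj ()) (root (prk (π-pair _ _)))
neutral-⟶ (proj e) (ξ-π r) = proj (neutral-⟶ e r)
neutral-⟶ (unν ()) (root (prk (μ-ν _)))
neutral-⟶ (unν e)  (ξ-μ r) = unν (neutral-⟶ e r)
neutral-⟶ abs      (root (prk (▶◀-pair p i))) = bowtie-neutral (classical p)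
neutral-⟶ abs      (root (prk (▶◀-inj p i)))  = bowtie-neutral (classical p)
neutral-⟶ abs      (root (prk (▶◀-ν p)))      = bowtie-neutral (classical (opposite p))
neutral-⟶ abs      (ξ-▶◀₁ r) = abs
neutral-⟶ abs      (ξ-▶◀₂ r) = abs

SN-var : {x : Fin n} → SN (var x)
SN-var = acc λ { (root (prk ())) }

SN-pair : ∀ {p} {t s : Term n} → SN t → SN s → SN (⟨ t , s ⟩^ p)
SN-pair (acc f) (acc g) = acc λ
  { (root (prk ())) ; (ξ-pair₁ r) → SN-pair (f r) (acc g) ; (ξ-pair₂ r) → SN-pair (acc f) (g r) }

SN-inj : ∀ {p i} {t : Term n} → SN t → SN (inj p i t)
SN-inj (acc f) = acc λ { (root (prk ())) ; (ξ-inj r) → SN-inj (f r) }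

SN-ν : ∀ {p} {t : Term n} → SN t → SN (ν p t)
SN-ν (acc f) = acc λ { (root (prk ())) ; (ξ-ν r) → SN-ν (f r) }

SN-IC : ∀ {p P} {t : Term (suc n)} → SN t → SN (IC p P t)
SN-IC a@(acc f) = acc λ
  { (root (prk ()))
  -- The η-reduct sits inside the body, up to weakening, and inherits strong normalisation from it.
  ; (root (η p)) → SN-reflect weaken (rename-⟶ suc) (SN-reflect (_•⟨ p ⟩ _) ξ-•₁ a)
  ; (ξ-IC r) → SN-IC (f r) }

SNF-proj : ∀ {p i} → SNF {n} (proj p i)
SNF-proj = acc λ ()

SNF-unν : ∀ {p} → SNF {n} (unν p)
SNF-unν = acc λ ()

SNF-app : ∀ {p} {s : Term n} → SN s → SNF (app p s)
SNF-app (acc f) = acc λ { (app r) → SNF-app (f r) }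

SNF-case : ∀ {p P Q} {s u : Term (suc n)} → SN s → SN u → SNF (case p P s Q u)
SNF-case (acc f) (acc g) = acc λ
  { (case₁ r) → SNF-case (f r) (acc g) ; (case₂ r) → SNF-case (acc f) (g r) }

SNF-absˡ : ∀ {Q} {s : Term n} → SN s → SNF (absˡ Q s)
SNF-absˡ (acc f) = acc λ { (absˡ r) → SNF-absˡ (f r) }

SNF-absʳ : ∀ {Q} {s : Term n} → SN s → SNF (absʳ Q s)
SNF-absʳ (acc f) = acc λ { (absʳ r) → SNF-absʳ (f r) }

SN-plug⁻ : ∀ F {t : Term n} → SN (plug F t) → SN t
SN-plug⁻ F = SN-reflect (plug F) (plug-⟶ F)

SN-plug-neutral : ∀ {F} {t : Term n} → SNF F → Neutral t → SN t → SN (plug F t)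
SN-plug-neutral {F = F} {t} (acc f) e (acc g) = acc λ r → go (plug-step F r)
  where
  go : ∀ {u} → PlugStep F t u → SN u
  go (redex r) = ⊥-elim (neutral-¬intro e (redex-intro F r))
  go (inner r) = SN-plug-neutral (acc f) (neutral-⟶ e r) (g r)
  go (outer r) = SN-plug-neutral (f r) e (acc g)

infix 3 _⇛_

-- The untyped trace of `_⊢_⇒_`: a contraction at the base of a stack of frames, with strong
-- normalisation of both halves of the redex as the measure for the expansion lemmas.
data _⇛_ {n} : Term n → Term n → Set where
  redex : ∀ F {t u} → SNF F → SN t → plug F t ↦ u → plug F t ⇛ u
  frame : ∀ F {t u} → t ⇛ u → plug F t ⇛ plug F u

⇛-¬intro : {t u : Term n} → t ⇛ u → ¬ Intro t
⇛-¬intro (redex F _ _ _) = plug-¬intro F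
⇛-¬intro (frame F _)     = plug-¬intro F

data FrameStep (F : Frame n) (t u : Term n) : Term n → Set where
  contract : FrameStep F t u (plug F u)
  inner    : ∀ {t′ u′} → t ⟶ t′ → t′ ⇛ u′ → u ⟶* u′ → FrameStep F t u (plug F t′)
  outer    : ∀ {G} → F ⟶F G → FrameStep F t u (plug G t)

mutual
  frame-step : ∀ F {t u s : Term n} → t ⇛ u → plug F t ⟶ s → FrameStep F t u s
  frame-step F h r with plug-step F r
  ... | redex k = ⊥-elim (⇛-¬intro h (redex-intro F k))
  ... | outer k = outer k
  ... | inner k with ⇛-⟶ h k
  ...   | inj₁ refl          = contract
  ...   | inj₂ (_ , h′ , rs) = inner k h′ rs

  -- Head contraction commutes with every other step. A term that admits a head contraction is no
  -- introduction, so the frames around it cannot form a redex with it; hence a step contracts the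
  -- same redex or leaves a residual at the head.
  ⇛-⟶ : {t u t′ : Term n} → t ⇛ u → t ⟶ t′ → t′ ≡ u ⊎ ∃[ u′ ] (t′ ⇛ u′ × u ⟶* u′)
  ⇛-⟶ (redex F (acc f) (acc g) h) r with plug-step F r | ↦-⟶ h r
  ... | _       | inj₁ eq            = inj₁ eq
  ... | redex k | inj₂ _             = inj₁ (↦-deterministic k h)
  ... | inner k | inj₂ (_ , h′ , rs) = inj₂ (_ , redex F (acc f) (g k) h′ , rs)
  ... | outer k | inj₂ (_ , h′ , rs) = inj₂ (_ , redex _ (f k) (acc g) h′ , rs)
  ⇛-⟶ (frame F h) r with frame-step F h r
  ... | contract      = inj₁ refl
  ... | inner _ h′ rs = inj₂ (_ , frame F h′ , gmap (plug F) (plug-⟶ F) rs)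
  ... | outer k       = inj₂ (_ , frame _ h , plug-⟶F k ◅ ε)

SN-redex : ∀ F {t u : Term n} → SNF F → SN t → plug F t ↦ u → SN u → SN (plug F t)
SN-redex F {t} {u} (acc f) (acc g) h a = acc λ r → go (plug-step F r) (↦-⟶ h r)
  where
  go : ∀ {t′} → PlugStep F t t′ → t′ ≡ u ⊎ ∃[ u′ ] (t′ ↦ u′ × u ⟶* u′) → SN t′
  go _         (inj₁ refl)          = a
  go (redex k) (inj₂ _)             = transport SN (↦-deterministic h k) a
  go (inner k) (inj₂ (_ , h′ , rs)) = SN-redex F (acc f) (g k) h′ (SN-⟶* a rs)
  go (outer k) (inj₂ (_ , h′ , rs)) = SN-redex _ (f k) (acc g) h′ (SN-⟶* a rs)

-- Lexicographic induction on `SN t` and `SN (plug F u)`: a step in the hole decreases the first,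
-- while a step of the frame is also a step of `plug F u` and decreases the second.
SN-frame : ∀ F {t u : Term n} → SN t → t ⇛ u → SN (plug F u) → SN (plug F t)
SN-frame F {t} {u} a h b = acc λ r → go F a h b (frame-step F h r)
  where
  go : ∀ F {t u t′ : Term n} → SN t → t ⇛ u → SN (plug F u) → FrameStep F t u t′ → SN t′
  go F a h b contract          = b
  go F (acc f) h b (inner k h′ rs)   = SN-frame F (f k) h′ (SN-⟶* b (gmap (plug F) (plug-⟶ F) rs))
  go F a h (acc g) (outer k)         = SN-frame _ a h (g (plug-⟶F k))

SN-⇛ : {t u : Term n} → t ⇛ u → SN u → SN t
SN-⇛ (redex F a a′ h) b = SN-redex F a a′ h b
SN-⇛ (frame F h)      b = SN-frame F (SN-⇛ h (SN-plug⁻ F b)) h b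

split-¬intro : ∀ {p P Q} {t v : Term n} {t₁ t₂} → Split p P Q t v t₁ t₂ → ¬ Intro t
split-¬intro here        ()
split-¬intro (there F _) = plug-¬intro F

data SplitStep (p : Sign) (P Q : Type) (u v : Term n) (t₁ t₂ : Term (suc n)) : Set where
  scrutinee : ∀ {v′} → v ⟶ v′ → Split p P Q u v′ t₁ t₂ → SplitStep p P Q u v t₁ t₂
  both      : ∀ {u₁ u₂} → t₁ ⟶ u₁ → t₂ ⟶ u₂ → Split p P Q u v u₁ u₂ → SplitStep p P Q u v t₁ t₂
  first     : ∀ {u₁} → t₁ ⟶ u₁ → Split p P Q u v u₁ t₂ → SplitStep p P Q u v t₁ t₂
  second    : ∀ {u₂} → t₂ ⟶ u₂ → Split p P Q u v t₁ u₂ → SplitStep p P Q u v t₁ t₂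

-- A neutral scrutinee is no injection and a stacked case distinction is no introduction, so no
-- redex arises along the stack. A step of the stack itself shows in both branches, as each contains
-- a copy of the stack.
split-⟶ : ∀ {p P Q} {t u v : Term n} {t₁ t₂} → Split p P Q t v t₁ t₂ → Neutral v → t ⟶ u →
          SplitStep p P Q u v t₁ t₂
split-⟶ here () (root (prk (δ-inj _ _)))
split-⟶ here e (ξ-δ₀ r) = scrutinee r here
split-⟶ here e (ξ-δ₁ r) = first r here
split-⟶ here e (ξ-δ₂ r) = second r here
split-⟶ (there F S) e r with plug-step F r
... | redex k = ⊥-elim (split-¬intro S (redex-intro F k))
... | outer k = both (plug-⟶F (weaken-⟶F k)) (plug-⟶F (weaken-⟶F k)) (there _ S)
... | inner k with split-⟶ S e k
...   | scrutinee j S′ = scrutinee j (there F S′)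
...   | both j j′ S′   = both (plug-⟶ (weakenF F) j) (plug-⟶ (weakenF F) j′) (there F S′)
...   | first j S′     = first (plug-⟶ (weakenF F) j) (there F S′)
...   | second j S′    = second (plug-⟶ (weakenF F) j) (there F S′)

-- Soundness of `split` for a reduction without commuting conversions: every step of `t` is matched
-- by a step of the scrutinee or of a branch under its stack, and none of these three is ever
-- expanded.
SN-split : ∀ {p P Q} {t v : Term n} {t₁ t₂} → Split p P Q t v t₁ t₂ → Neutral v →
           SN v → SN t₁ → SN t₂ → SN t
SN-split S e (acc f) (acc g) (acc h) = acc λ r → go (split-⟶ S e r)
  where
  go : ∀ {u} → SplitStep _ _ _ u _ _ _ → SN u
  go (scrutinee j S′) = SN-split S′ (neutral-⟶ e j) (f j) (acc g) (acc h)
  go (both j j′ S′)   = SN-split S′ e (acc f) (g j) (h j′)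
  go (first j S′)     = SN-split S′ e (acc f) (g j) (acc h)
  go (second j S′)    = SN-split S′ e (acc f) (acc g) (h j)

-- A weakened frame does not see the instantiated variable, so a contraction in a branch can be read
-- as one below the frame.
pick-[]-plug : ∀ F i {t₁ t₂ : Term (suc n)} {w} →
               pick i (plug (weakenF F) t₁) (plug (weakenF F) t₂) [ w ] ≡ plug F (pick i t₁ t₂ [ w ])
pick-[]-plug F i {w = w} =
  trans (cong (_[ w ]) (sym (pick-∘ (plug (weakenF F)) i)))
    (trans (subst-plug (subst₀ w) (weakenF F)) (cong (λ G → plug G _) (lemma F)))
  where
  lemma : ∀ F → substF (subst₀ w) (weakenF F) ≡ F
  lemma (app p s)        = cong (app p) (weaken-[] s w)
  lemma (proj _ _)       = refl
  lemma (unν _)          = refl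
  lemma (case p P s Q u) = cong₂ (λ s u → case p P s Q u) (ext-suc s) (ext-suc u)
    where
    ext-suc : ∀ s → subst (exts (subst₀ w)) (rename (ext suc) s) ≡ s
    ext-suc s = trans (subst-rename (exts-ext (λ _ → refl)) s) (subst-var (exts-var (λ _ → refl)) s)
  lemma (absˡ Q s)       = cong (absˡ Q) (weaken-[] s w)
  lemma (absʳ Q s)       = cong (absʳ Q) (weaken-[] s w)

split-⇛ : ∀ {p P Q t w} {t₁ t₂ : Term (suc n)} i → Split p P Q t (inj p i w) t₁ t₂ →
          SN w → SN t₁ → SN t₂ → t ⇛ pick i t₁ t₂ [ w ]
split-⇛ {p = p} i here        a a₁ a₂ = redex (case _ _ _ _ _) (SNF-case a₁ a₂) (SN-inj a) (δ-inj p i)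
split-⇛ i (there F S) a a₁ a₂ =
  transport (plug F _ ⇛_) (sym (pick-[]-plug F i))
    (frame F (split-⇛ i S a (SN-plug⁻ (weakenF F) a₁) (SN-plug⁻ (weakenF F) a₂)))

SN-bowtie⁻ : ∀ M {Q} {t s : Term n} → SN (bowtie M Q t s) → SN t × SN s
SN-bowtie⁻ (strong _) a = SN-plug⁻ (absˡ _ _) a , SN-plug⁻ (absʳ _ _) a
SN-bowtie⁻ ⊕          a =
  SN-plug⁻ (app _ _) (SN-plug⁻ (absˡ _ _) a) , SN-plug⁻ (app _ _) (SN-plug⁻ (absʳ _ _) a)
SN-bowtie⁻ ⊖          a =
  SN-plug⁻ (app _ _) (SN-plug⁻ (absˡ _ _) a) , SN-plug⁻ (app _ _) (SN-plug⁻ (absʳ _ _) a)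

ne-neutral : ∀ {Γ : Ctx n} {t P} → Ne Γ t P → Neutral t
ne-neutral (var _)      = var
ne-neutral (app _ d _)  = app (ne-neutral d)
ne-neutral (proj _ _ d) = proj (ne-neutral d)
ne-neutral (unν _ d)    = unν (ne-neutral d)
ne-neutral (abs _)      = abs

mutual
  sn⇒SN : ∀ {Γ : Ctx n} {t J} → Sn Γ t J → SN t
  sn⇒SN (ne d)              = ne⇒SN d
  sn⇒SN (exp r d)           = SN-⇛ (⇒⇒⇛ r (sn⇒SN d)) (sn⇒SN d)
  sn⇒SN (split _ S d d₁ d₂) = SN-split S (ne-neutral d) (ne⇒SN d) (sn⇒SN d₁) (sn⇒SN d₂)
  sn⇒SN (pair _ d d′)       = SN-pair (sn⇒SN d) (sn⇒SN d′)
  sn⇒SN (inj _ _ d)         = SN-inj (sn⇒SN d)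
  sn⇒SN (ν _ d)             = SN-ν (sn⇒SN d)
  sn⇒SN (ic _ d)            = SN-IC (sn⇒SN d)
  sn⇒SN (absˡ _ d d′)       = SN-plug-neutral (SNF-absˡ (sn⇒SN d′)) (ne-neutral d) (ne⇒SN d)
  sn⇒SN (absʳ _ d d′)       = SN-plug-neutral (SNF-absʳ (sn⇒SN d)) (ne-neutral d′) (ne⇒SN d′)

  ne⇒SN : ∀ {Γ : Ctx n} {t P} → Ne Γ t P → SN t
  ne⇒SN (var _)      = SN-var
  ne⇒SN (app _ d d′) = SN-plug-neutral (SNF-app (sn⇒SN d′)) (ne-neutral d) (ne⇒SN d)
  ne⇒SN (proj _ _ d) = SN-plug-neutral SNF-proj (ne-neutral d) (ne⇒SN d)
  ne⇒SN (unν _ d)    = SN-plug-neutral SNF-unν (ne-neutral d) (ne⇒SN d)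
  ne⇒SN (abs d)      = sn⇒SN d

  -- The normalisation premises of a redex come from two sources: for parts that may be erased, from
  -- the `Sn` premises of `_⊢_⇒_`; for parts that survive, from `SN u`.
  ⇒⇒⇛ : ∀ {Γ : Ctx n} {t u} → Γ ⊢ t ⇒ u → SN u → t ⇛ u
  ⇒⇒⇛ (β d) a =
    redex (app _ _) (SNF-app (sn⇒SN d)) (SN-IC (SN-reflect (_[ _ ]) (subst-⟶ _) a)) (IC-• _)
  ⇒⇒⇛ (π-pair i d d′) a =
    redex (proj _ _) SNF-proj (SN-pair (sn⇒SN d) (sn⇒SN d′)) (π-pair _ i)
  ⇒⇒⇛ μ-ν a = redex (unν _) SNF-unν (SN-ν a) (μ-ν _)
  ⇒⇒⇛ (δ-inj i S d d₁ d₂) a = split-⇛ i S (sn⇒SN d) (sn⇒SN d₁) (sn⇒SN d₂)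
  ⇒⇒⇛ (▶◀-pair {p} i d d′) a =
    redex (absˡ _ _) (SNF-absˡ (SN-inj (proj₂ (SN-bowtie⁻ (classical p) a))))
      (SN-pair (sn⇒SN d) (sn⇒SN d′)) (▶◀-pair p i)
  ⇒⇒⇛ (▶◀-inj {p} i d d′) a =
    redex (absˡ _ _) (SNF-absˡ (SN-pair (sn⇒SN d) (sn⇒SN d′)))
      (SN-inj (proj₁ (SN-bowtie⁻ (classical p) a))) (▶◀-inj p i)
  ⇒⇒⇛ (▶◀-ν {p}) a =
    redex (absˡ _ _) (SNF-absˡ (SN-ν (proj₂ (SN-bowtie⁻ (classical (opposite p)) a))))
      (SN-ν (proj₁ (SN-bowtie⁻ (classical (opposite p)) a))) (▶◀-ν p)
  ⇒⇒⇛ (frame F r) a = frame F (⇒⇒⇛ r (SN-plug⁻ F a))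

-- Subject reduction

rename-⊢ : ∀ {ρ} → Renaming Γ Δ ρ → ∀ {t P} → Γ ⊢ t ∶ P → Δ ⊢ rename ρ t ∶ P
rename-⊢ ρ∶ (ax eq)       = ax (trans (ρ∶ _) eq)
rename-⊢ ρ∶ (abs S d d′)  = abs S (rename-⊢ ρ∶ d) (rename-⊢ ρ∶ d′)
rename-⊢ ρ∶ (I∧⁺ d d′)    = I∧⁺ (rename-⊢ ρ∶ d) (rename-⊢ ρ∶ d′)
rename-⊢ ρ∶ (I∨⁻ d d′)    = I∨⁻ (rename-⊢ ρ∶ d) (rename-⊢ ρ∶ d′)
rename-⊢ ρ∶ (E∧⁺ i d)     = E∧⁺ i (rename-⊢ ρ∶ d)
rename-⊢ ρ∶ (E∨⁻ i d)     = E∨⁻ i (rename-⊢ ρ∶ d)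
rename-⊢ ρ∶ (I∨⁺ i d)     = I∨⁺ i (rename-⊢ ρ∶ d)
rename-⊢ ρ∶ (I∧⁻ i d)     = I∧⁻ i (rename-⊢ ρ∶ d)
rename-⊢ ρ∶ (E∨⁺ d d₁ d₂) =
  E∨⁺ (rename-⊢ ρ∶ d) (rename-⊢ (ext-Renaming ρ∶) d₁) (rename-⊢ (ext-Renaming ρ∶) d₂)
rename-⊢ ρ∶ (E∧⁻ d d₁ d₂) =
  E∧⁻ (rename-⊢ ρ∶ d) (rename-⊢ (ext-Renaming ρ∶) d₁) (rename-⊢ (ext-Renaming ρ∶) d₂)
rename-⊢ ρ∶ (I¬⁺ d)       = I¬⁺ (rename-⊢ ρ∶ d)
rename-⊢ ρ∶ (I¬⁻ d)       = I¬⁻ (rename-⊢ ρ∶ d)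
rename-⊢ ρ∶ (E¬⁺ d)       = E¬⁺ (rename-⊢ ρ∶ d)
rename-⊢ ρ∶ (E¬⁻ d)       = E¬⁻ (rename-⊢ ρ∶ d)
rename-⊢ ρ∶ (IC⁺ d)       = IC⁺ (rename-⊢ (ext-Renaming ρ∶) d)
rename-⊢ ρ∶ (IC⁻ d)       = IC⁻ (rename-⊢ (ext-Renaming ρ∶) d)
rename-⊢ ρ∶ (EC⁺ d d′)    = EC⁺ (rename-⊢ ρ∶ d) (rename-⊢ ρ∶ d′)
rename-⊢ ρ∶ (EC⁻ d d′)    = EC⁻ (rename-⊢ ρ∶ d) (rename-⊢ ρ∶ d′)

-- Strengthening, which subject reduction for η applies with `ρ = suc`. Typing sees a variable only
-- through its type, and `Renaming` equates these types, so the induction on `t` runs backwards.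
rename-⊢⁻ : ∀ {ρ} → Renaming Γ Δ ρ → ∀ t {P} → Δ ⊢ rename ρ t ∶ P → Γ ⊢ t ∶ P
rename-⊢⁻ ρ∶ (var x) (ax eq)                = ax (trans (sym (ρ∶ x)) eq)
rename-⊢⁻ ρ∶ (t ▶◀[ _ ] s) (abs S d d′)     = abs S (rename-⊢⁻ ρ∶ t d) (rename-⊢⁻ ρ∶ s d′)
rename-⊢⁻ ρ∶ (⟨ t , s ⟩^ _) (I∧⁺ d d′)      = I∧⁺ (rename-⊢⁻ ρ∶ t d) (rename-⊢⁻ ρ∶ s d′)
rename-⊢⁻ ρ∶ (⟨ t , s ⟩^ _) (I∨⁻ d d′)      = I∨⁻ (rename-⊢⁻ ρ∶ t d) (rename-⊢⁻ ρ∶ s d′)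
rename-⊢⁻ ρ∶ (π _ i t) (E∧⁺ i d)            = E∧⁺ i (rename-⊢⁻ ρ∶ t d)
rename-⊢⁻ ρ∶ (π _ i t) (E∨⁻ i d)            = E∨⁻ i (rename-⊢⁻ ρ∶ t d)
rename-⊢⁻ ρ∶ (inj _ i t) (I∨⁺ i d)          = I∨⁺ i (rename-⊢⁻ ρ∶ t d)
rename-⊢⁻ ρ∶ (inj _ i t) (I∧⁻ i d)          = I∧⁻ i (rename-⊢⁻ ρ∶ t d)
rename-⊢⁻ ρ∶ (δ _ t _ s _ u) (E∨⁺ d d₁ d₂)  =
  E∨⁺ (rename-⊢⁻ ρ∶ t d) (rename-⊢⁻ (ext-Renaming ρ∶) s d₁) (rename-⊢⁻ (ext-Renaming ρ∶) u d₂)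
rename-⊢⁻ ρ∶ (δ _ t _ s _ u) (E∧⁻ d d₁ d₂)  =
  E∧⁻ (rename-⊢⁻ ρ∶ t d) (rename-⊢⁻ (ext-Renaming ρ∶) s d₁) (rename-⊢⁻ (ext-Renaming ρ∶) u d₂)
rename-⊢⁻ ρ∶ (ν _ t) (I¬⁺ d)                = I¬⁺ (rename-⊢⁻ ρ∶ t d)
rename-⊢⁻ ρ∶ (ν _ t) (I¬⁻ d)                = I¬⁻ (rename-⊢⁻ ρ∶ t d)
rename-⊢⁻ ρ∶ (μ _ t) (E¬⁺ d)                = E¬⁺ (rename-⊢⁻ ρ∶ t d)
rename-⊢⁻ ρ∶ (μ _ t) (E¬⁻ d)                = E¬⁻ (rename-⊢⁻ ρ∶ t d)
rename-⊢⁻ ρ∶ (IC _ _ t) (IC⁺ d)             = IC⁺ (rename-⊢⁻ (ext-Renaming ρ∶) t d)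
rename-⊢⁻ ρ∶ (IC _ _ t) (IC⁻ d)             = IC⁻ (rename-⊢⁻ (ext-Renaming ρ∶) t d)
rename-⊢⁻ ρ∶ (t •⟨ _ ⟩ s) (EC⁺ d d′)        = EC⁺ (rename-⊢⁻ ρ∶ t d) (rename-⊢⁻ ρ∶ s d′)
rename-⊢⁻ ρ∶ (t •⟨ _ ⟩ s) (EC⁻ d d′)        = EC⁻ (rename-⊢⁻ ρ∶ t d) (rename-⊢⁻ ρ∶ s d′)

infix 3 _⊢s_∶_

_⊢s_∶_ : Ctx n → (Fin m → Term n) → Ctx m → Set
Δ ⊢s σ ∶ Γ = ∀ x → Δ ⊢ σ x ∶ lookup Γ x

exts-⊢s : ∀ {σ P} → Δ ⊢s σ ∶ Γ → P ∷ Δ ⊢s exts σ ∶ P ∷ Γ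
exts-⊢s σ∶ zero    = ax refl
exts-⊢s σ∶ (suc x) = rename-⊢ (λ _ → refl) (σ∶ x)

subst-⊢ : ∀ {σ} → Δ ⊢s σ ∶ Γ → ∀ {t P} → Γ ⊢ t ∶ P → Δ ⊢ subst σ t ∶ P
subst-⊢ σ∶ (ax refl)     = σ∶ _
subst-⊢ σ∶ (abs S d d′)  = abs S (subst-⊢ σ∶ d) (subst-⊢ σ∶ d′)
subst-⊢ σ∶ (I∧⁺ d d′)    = I∧⁺ (subst-⊢ σ∶ d) (subst-⊢ σ∶ d′)
subst-⊢ σ∶ (I∨⁻ d d′)    = I∨⁻ (subst-⊢ σ∶ d) (subst-⊢ σ∶ d′)
subst-⊢ σ∶ (E∧⁺ i d)     = E∧⁺ i (subst-⊢ σ∶ d)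
subst-⊢ σ∶ (E∨⁻ i d)     = E∨⁻ i (subst-⊢ σ∶ d)
subst-⊢ σ∶ (I∨⁺ i d)     = I∨⁺ i (subst-⊢ σ∶ d)
subst-⊢ σ∶ (I∧⁻ i d)     = I∧⁻ i (subst-⊢ σ∶ d)
subst-⊢ σ∶ (E∨⁺ d d₁ d₂) =
  E∨⁺ (subst-⊢ σ∶ d) (subst-⊢ (exts-⊢s σ∶) d₁) (subst-⊢ (exts-⊢s σ∶) d₂)
subst-⊢ σ∶ (E∧⁻ d d₁ d₂) =
  E∧⁻ (subst-⊢ σ∶ d) (subst-⊢ (exts-⊢s σ∶) d₁) (subst-⊢ (exts-⊢s σ∶) d₂)
subst-⊢ σ∶ (I¬⁺ d)       = I¬⁺ (subst-⊢ σ∶ d)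
subst-⊢ σ∶ (I¬⁻ d)       = I¬⁻ (subst-⊢ σ∶ d)
subst-⊢ σ∶ (E¬⁺ d)       = E¬⁺ (subst-⊢ σ∶ d)
subst-⊢ σ∶ (E¬⁻ d)       = E¬⁻ (subst-⊢ σ∶ d)
subst-⊢ σ∶ (IC⁺ d)       = IC⁺ (subst-⊢ (exts-⊢s σ∶) d)
subst-⊢ σ∶ (IC⁻ d)       = IC⁻ (subst-⊢ (exts-⊢s σ∶) d)
subst-⊢ σ∶ (EC⁺ d d′)    = EC⁺ (subst-⊢ σ∶ d) (subst-⊢ σ∶ d′)
subst-⊢ σ∶ (EC⁻ d d′)    = EC⁻ (subst-⊢ σ∶ d) (subst-⊢ σ∶ d′)

[]-⊢ : ∀ {b s P Q} → P ∷ Γ ⊢ b ∶ Q → Γ ⊢ s ∶ P → Γ ⊢ b [ s ] ∶ Q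
[]-⊢ d d′ = subst-⊢ (λ { zero → d′ ; (suc x) → ax refl }) d

bowtie-⊢ : ∀ {A p Q t s} → Γ ⊢ t ∶ A ^ classical p → Γ ⊢ s ∶ A ^ classical (opposite p) →
           Γ ⊢ bowtie (classical p) Q t s ∶ Q
bowtie-⊢ {p = + } d d′ = abs (strong _ +) (EC⁺ d d′) (EC⁻ d′ d)
bowtie-⊢ {p = - } d d′ = abs (strong _ -) (EC⁻ d d′) (EC⁺ d′ d)

↦-⊢ : ∀ {t u P} → Γ ⊢ t ∶ P → t ↦ u → Γ ⊢ u ∶ P
↦-⊢ (E∧⁺ zero (I∧⁺ d _))       (π-pair + zero)       = d
↦-⊢ (E∧⁺ (suc zero) (I∧⁺ _ d)) (π-pair + (suc zero)) = d
↦-⊢ (E∨⁻ zero (I∨⁻ d _))       (π-pair - zero)       = d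
↦-⊢ (E∨⁻ (suc zero) (I∨⁻ _ d)) (π-pair - (suc zero)) = d
↦-⊢ (E∨⁺ (I∨⁺ zero d) d₁ _)       (δ-inj + zero)       = []-⊢ d₁ d
↦-⊢ (E∨⁺ (I∨⁺ (suc zero) d) _ d₂) (δ-inj + (suc zero)) = []-⊢ d₂ d
↦-⊢ (E∧⁻ (I∧⁻ zero d) d₁ _)       (δ-inj - zero)       = []-⊢ d₁ d
↦-⊢ (E∧⁻ (I∧⁻ (suc zero) d) _ d₂) (δ-inj - (suc zero)) = []-⊢ d₂ d
↦-⊢ (E¬⁺ (I¬⁺ d)) (μ-ν +) = d
↦-⊢ (E¬⁻ (I¬⁻ d)) (μ-ν -) = d
↦-⊢ (EC⁺ (IC⁺ d) d′) (IC-• +) = []-⊢ d d′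
↦-⊢ (EC⁻ (IC⁻ d) d′) (IC-• -) = []-⊢ d d′
↦-⊢ (abs (strong _ +) (I∧⁺ d _) (I∧⁻ zero d′))       (▶◀-pair + zero)       = bowtie-⊢ d d′
↦-⊢ (abs (strong _ +) (I∧⁺ _ d) (I∧⁻ (suc zero) d′)) (▶◀-pair + (suc zero)) = bowtie-⊢ d d′
↦-⊢ (abs (strong _ -) (I∨⁻ d _) (I∨⁺ zero d′))       (▶◀-pair - zero)       = bowtie-⊢ d d′
↦-⊢ (abs (strong _ -) (I∨⁻ _ d) (I∨⁺ (suc zero) d′)) (▶◀-pair - (suc zero)) = bowtie-⊢ d d′
↦-⊢ (abs (strong _ +) (I∨⁺ zero d) (I∨⁻ d′ _))       (▶◀-inj + zero)       = bowtie-⊢ d d′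
↦-⊢ (abs (strong _ +) (I∨⁺ (suc zero) d) (I∨⁻ _ d′)) (▶◀-inj + (suc zero)) = bowtie-⊢ d d′
↦-⊢ (abs (strong _ -) (I∧⁻ zero d) (I∧⁺ d′ _))       (▶◀-inj - zero)       = bowtie-⊢ d d′
↦-⊢ (abs (strong _ -) (I∧⁻ (suc zero) d) (I∧⁺ _ d′)) (▶◀-inj - (suc zero)) = bowtie-⊢ d d′
↦-⊢ (abs (strong _ +) (I¬⁺ d) (I¬⁻ d′)) (▶◀-ν +) = bowtie-⊢ d d′
↦-⊢ (abs (strong _ -) (I¬⁻ d) (I¬⁺ d′)) (▶◀-ν -) = bowtie-⊢ d d′

⟶-⊢ : ∀ {t u P} → Γ ⊢ t ∶ P → t ⟶ u → Γ ⊢ u ∶ P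
⟶-⊢ d (root (prk r)) = ↦-⊢ d r
⟶-⊢ (IC⁺ (EC⁺ d _)) (root (η + {t = t})) = rename-⊢⁻ (λ _ → refl) t d
⟶-⊢ (IC⁻ (EC⁻ d _)) (root (η - {t = t})) = rename-⊢⁻ (λ _ → refl) t d
⟶-⊢ (abs S d d′)  (ξ-▶◀₁ r)  = abs S (⟶-⊢ d r) d′
⟶-⊢ (abs S d d′)  (ξ-▶◀₂ r)  = abs S d (⟶-⊢ d′ r)
⟶-⊢ (I∧⁺ d d′)    (ξ-pair₁ r) = I∧⁺ (⟶-⊢ d r) d′
⟶-⊢ (I∧⁺ d d′)    (ξ-pair₂ r) = I∧⁺ d (⟶-⊢ d′ r)
⟶-⊢ (I∨⁻ d d′)    (ξ-pair₁ r) = I∨⁻ (⟶-⊢ d r) d′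
⟶-⊢ (I∨⁻ d d′)    (ξ-pair₂ r) = I∨⁻ d (⟶-⊢ d′ r)
⟶-⊢ (E∧⁺ i d)     (ξ-π r)     = E∧⁺ i (⟶-⊢ d r)
⟶-⊢ (E∨⁻ i d)     (ξ-π r)     = E∨⁻ i (⟶-⊢ d r)
⟶-⊢ (I∨⁺ i d)     (ξ-inj r)   = I∨⁺ i (⟶-⊢ d r)
⟶-⊢ (I∧⁻ i d)     (ξ-inj r)   = I∧⁻ i (⟶-⊢ d r)
⟶-⊢ (E∨⁺ d d₁ d₂) (ξ-δ₀ r)    = E∨⁺ (⟶-⊢ d r) d₁ d₂
⟶-⊢ (E∨⁺ d d₁ d₂) (ξ-δ₁ r)    = E∨⁺ d (⟶-⊢ d₁ r) d₂
⟶-⊢ (E∨⁺ d d₁ d₂) (ξ-δ₂ r)    = E∨⁺ d d₁ (⟶-⊢ d₂ r)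
⟶-⊢ (E∧⁻ d d₁ d₂) (ξ-δ₀ r)    = E∧⁻ (⟶-⊢ d r) d₁ d₂
⟶-⊢ (E∧⁻ d d₁ d₂) (ξ-δ₁ r)    = E∧⁻ d (⟶-⊢ d₁ r) d₂
⟶-⊢ (E∧⁻ d d₁ d₂) (ξ-δ₂ r)    = E∧⁻ d d₁ (⟶-⊢ d₂ r)
⟶-⊢ (I¬⁺ d)       (ξ-ν r)     = I¬⁺ (⟶-⊢ d r)
⟶-⊢ (I¬⁻ d)       (ξ-ν r)     = I¬⁻ (⟶-⊢ d r)
⟶-⊢ (E¬⁺ d)       (ξ-μ r)     = E¬⁺ (⟶-⊢ d r)
⟶-⊢ (E¬⁻ d)       (ξ-μ r)     = E¬⁻ (⟶-⊢ d r)
⟶-⊢ (IC⁺ d)       (ξ-IC r)    = IC⁺ (⟶-⊢ d r)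
⟶-⊢ (IC⁻ d)       (ξ-IC r)    = IC⁻ (⟶-⊢ d r)
⟶-⊢ (EC⁺ d d′)    (ξ-•₁ r)    = EC⁺ (⟶-⊢ d r) d′
⟶-⊢ (EC⁺ d d′)    (ξ-•₂ r)    = EC⁺ d (⟶-⊢ d′ r)
⟶-⊢ (EC⁻ d d′)    (ξ-•₁ r)    = EC⁻ (⟶-⊢ d r) d′
⟶-⊢ (EC⁻ d d′)    (ξ-•₂ r)    = EC⁻ d (⟶-⊢ d′ r)

-- Confluence

weaken-injective : {t u : Term n} → weaken t ≡ weaken u → t ≡ u
weaken-injective {t = t} {u} eq =
  trans (sym (weaken-[] t t)) (trans (cong _[ t ] eq) (weaken-[] u t))

▶◀-injective : ∀ {Q} {t t′ s s′ : Term n} → t ▶◀[ Q ] s ≡ t′ ▶◀[ Q ] s′ → t ≡ t′ × s ≡ s′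
▶◀-injective refl = refl , refl

pair-injective : ∀ {p} {t t′ s s′ : Term n} → ⟨ t , s ⟩^ p ≡ ⟨ t′ , s′ ⟩^ p → t ≡ t′ × s ≡ s′
pair-injective refl = refl , refl

π-injective : ∀ {p i} {t t′ : Term n} → π p i t ≡ π p i t′ → t ≡ t′
π-injective refl = refl

inj-injective : ∀ {p i} {t t′ : Term n} → Term.inj p i t ≡ Term.inj p i t′ → t ≡ t′
inj-injective refl = refl

δ-injective : ∀ {p P Q} {t t′ : Term n} {s s′ u u′} → δ p t P s Q u ≡ δ p t′ P s′ Q u′ →
              t ≡ t′ × s ≡ s′ × u ≡ u′
δ-injective refl = refl , refl , refl

ν-injective : ∀ {p} {t t′ : Term n} → Term.ν p t ≡ Term.ν p t′ → t ≡ t′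
ν-injective refl = refl

μ-injective : ∀ {p} {t t′ : Term n} → μ p t ≡ μ p t′ → t ≡ t′
μ-injective refl = refl

IC-injective : ∀ {p P} {t t′ : Term (suc n)} → IC p P t ≡ IC p P t′ → t ≡ t′
IC-injective refl = refl

•-injective : ∀ {p} {t t′ s s′ : Term n} → t •⟨ p ⟩ s ≡ t′ •⟨ p ⟩ s′ → t ≡ t′ × s ≡ s′
•-injective refl = refl , refl

-- Reduction creates no free variables: substitutions that agree on t agree on u.
⟶-agree : {t u : Term m} → t ⟶ u → (σ τ : Fin m → Term n) →
          subst σ t ≡ subst τ t → subst σ u ≡ subst τ u
⟶-agree (root (prk r)) σ τ eq =
  ↦-deterministic (transport (_↦ _) eq (subst-↦ σ r)) (subst-↦ τ r)
⟶-agree (root (η p {t = t})) σ τ eq =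
  weaken-injective (trans (sym (subst-weaken σ t))
    (trans (proj₁ (•-injective (IC-injective eq))) (subst-weaken τ t)))
⟶-agree (ξ-▶◀₁ r) σ τ eq with ▶◀-injective eq
... | e₁ , e₂ = cong₂ _▶◀[ _ ]_ (⟶-agree r σ τ e₁) e₂
⟶-agree (ξ-▶◀₂ r) σ τ eq with ▶◀-injective eq
... | e₁ , e₂ = cong₂ _▶◀[ _ ]_ e₁ (⟶-agree r σ τ e₂)
⟶-agree (ξ-pair₁ r) σ τ eq with pair-injective eq
... | e₁ , e₂ = cong₂ (⟨_,_⟩^ _) (⟶-agree r σ τ e₁) e₂
⟶-agree (ξ-pair₂ r) σ τ eq with pair-injective eq
... | e₁ , e₂ = cong₂ (⟨_,_⟩^ _) e₁ (⟶-agree r σ τ e₂)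
⟶-agree (ξ-π r) σ τ eq = cong (π _ _) (⟶-agree r σ τ (π-injective eq))
⟶-agree (ξ-inj r) σ τ eq = cong (Term.inj _ _) (⟶-agree r σ τ (inj-injective eq))
⟶-agree (ξ-δ₀ r) σ τ eq with δ-injective eq
... | e₁ , e₂ , e₃ = cong-δ (⟶-agree r σ τ e₁) e₂ e₃
⟶-agree (ξ-δ₁ r) σ τ eq with δ-injective eq
... | e₁ , e₂ , e₃ = cong-δ e₁ (⟶-agree r (exts σ) (exts τ) e₂) e₃
⟶-agree (ξ-δ₂ r) σ τ eq with δ-injective eq
... | e₁ , e₂ , e₃ = cong-δ e₁ e₂ (⟶-agree r (exts σ) (exts τ) e₃)
⟶-agree (ξ-ν r) σ τ eq = cong (Term.ν _) (⟶-agree r σ τ (ν-injective eq))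
⟶-agree (ξ-μ r) σ τ eq = cong (μ _) (⟶-agree r σ τ (μ-injective eq))
⟶-agree (ξ-IC r) σ τ eq = cong (IC _ _) (⟶-agree r (exts σ) (exts τ) (IC-injective eq))
⟶-agree (ξ-•₁ r) σ τ eq with •-injective eq
... | e₁ , e₂ = cong₂ _•⟨ _ ⟩_ (⟶-agree r σ τ e₁) e₂
⟶-agree (ξ-•₂ r) σ τ eq with •-injective eq
... | e₁ , e₂ = cong₂ _•⟨ _ ⟩_ e₁ (⟶-agree r σ τ e₂)

-- The identity and the substitution sending the new variable to `weaken t` agree on `weaken t`,
-- hence on `u` by `⟶-agree`. The second substitution sends `u` to `weaken (u [ t ])`, which
-- supplies the witness.
weaken-⟶⁻ : {t : Term n} {u : Term (suc n)} → weaken t ⟶ u → ∃[ t′ ] (u ≡ weaken t′ × t ⟶ t′)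
weaken-⟶⁻ {t = t} {u} r =
  u [ t ] ,
  trans (sym (subst-var (λ _ → refl) u))
    (trans (⟶-agree r var (weaken t ◂ λ x → var (suc x))
             (trans (subst-var (λ _ → refl) (weaken t))
               (trans (rename-as-subst suc t) (sym (subst-rename (λ _ → refl) t)))))
           (sym (rename-subst (λ { zero → refl ; (suc _) → refl }) u))) ,
  transport (_⟶ u [ t ]) (weaken-[] t t) (subst-⟶ _ r)

Joinable : Term n → Term n → Set
Joinable u v = ∃[ w ] (u ⟶* w × v ⟶* w)

join-≡ : {u v : Term n} → u ≡ v → Joinable u v
join-≡ refl = _ , ε , ε

join-sym : {u v : Term n} → Joinable u v → Joinable v u
join-sym (_ , rs , rs′) = _ , rs′ , rs

join-cong : (f : Term m → Term n) → (∀ {t u} → t ⟶ u → f t ⟶ f u) →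
            ∀ {u v} → Joinable u v → Joinable (f u) (f v)
join-cong f mono (_ , rs , rs′) = _ , gmap f mono rs , gmap f mono rs′

join-step : {u v w : Term n} → u ⟶ w → v ⟶ w → Joinable u v
join-step r r′ = _ , r ◅ ε , r′ ◅ ε

↦-join : {t u v : Term n} → t ↦ u → t ⟶ v → Joinable u v
↦-join h r with ↦-⟶ h r
... | inj₁ eq             = join-≡ (sym eq)
... | inj₂ (_ , h′ , rs) = _ , rs , prk⟶ h′ ◅ ε

IC-annotation : ∀ {p P P′ c Q} → Γ ⊢ IC p P (weaken (IC p P′ c) •⟨ p ⟩ var zero) ∶ Q → P ≡ P′
IC-annotation (IC⁺ (EC⁺ (IC⁺ _) _)) = refl
IC-annotation (IC⁻ (EC⁻ (IC⁻ _) _)) = refl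

ext-suc-[] : (c : Term (suc n)) → rename (ext suc) c [ var zero ] ≡ c
ext-suc-[] c = trans (subst-rename (λ { zero → refl ; (suc _) → refl }) c) (subst-var (λ _ → refl) c)

η-join-IC : ∀ {p P P′ Q} {Γ : Ctx n} {t c c′} → t ≡ IC p P′ c → IC p P′ c′ ≡ weaken t →
            Γ ⊢ IC p P (weaken t •⟨ p ⟩ var zero) ∶ Q → Joinable t (IC p P (c′ [ var zero ]))
η-join-IC refl refl d with refl ← IC-annotation d =
  join-≡ (cong (IC _ _) (sym (ext-suc-[] _)))

-- The function side is generalised to `s` with an equation, since `weaken t` is not a constructor
-- form and would block matching on a contraction at the root.
η-join : ∀ {Γ : Ctx n} {p P t s b Q} → Γ ⊢ IC p P (weaken t •⟨ p ⟩ var zero) ∶ Q → s ≡ weaken t →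
         s •⟨ p ⟩ var zero ⟶ b → Joinable t (IC p P b)
η-join {t = t} d eq (root (prk (IC-• p))) =
  -- As `t` equals `weaken t [ t ]`, it is an `IC` as soon as `weaken t` is one, with the same
  -- annotation.
  η-join-IC (trans (sym (weaken-[] t t)) (cong _[ t ] (sym eq))) eq d
η-join d refl (ξ-•₁ r) with weaken-⟶⁻ r
... | _ , refl , r′ = _ , r′ ◅ ε , root (η _) ◅ ε
η-join d eq (ξ-•₂ (root (prk ())))

IC-join : ∀ {Γ : Ctx n} {p P b t v Q} → Γ ⊢ IC p P b ∶ Q → b ≡ weaken t •⟨ p ⟩ var zero →
          IC p P b ⟶ v → Joinable t v
IC-join d eq   (root (prk ()))
IC-join d eq   (root (η _)) = join-≡ (sym (weaken-injective (proj₁ (•-injective eq))))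
IC-join d refl (ξ-IC r) = η-join d refl r

root-join : ∀ {Γ : Ctx n} {t u v P} → Γ ⊢ t ∶ P → t ↦η u → t ⟶ v → Joinable u v
root-join d (prk h) r = ↦-join h r
root-join d (η _)   r = IC-join d refl r

join : ∀ {Γ : Ctx n} {t u v P} → Γ ⊢ t ∶ P → t ⟶ u → t ⟶ v → Joinable u v
join d (root h) r = root-join d h r
join d r (root h) = join-sym (root-join d h r)
join (abs _ d _) (ξ-▶◀₁ r) (ξ-▶◀₁ r′) = join-cong (_▶◀[ _ ] _) ξ-▶◀₁ (join d r r′)
join (abs _ _ d) (ξ-▶◀₂ r) (ξ-▶◀₂ r′) = join-cong (_ ▶◀[ _ ]_) ξ-▶◀₂ (join d r r′)
join d (ξ-▶◀₁ r) (ξ-▶◀₂ r′) = join-step (ξ-▶◀₂ r′) (ξ-▶◀₁ r)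
join d (ξ-▶◀₂ r) (ξ-▶◀₁ r′) = join-step (ξ-▶◀₁ r′) (ξ-▶◀₂ r)
join (I∧⁺ d _) (ξ-pair₁ r) (ξ-pair₁ r′) = join-cong (λ t → ⟨ t , _ ⟩^ _) ξ-pair₁ (join d r r′)
join (I∨⁻ d _) (ξ-pair₁ r) (ξ-pair₁ r′) = join-cong (λ t → ⟨ t , _ ⟩^ _) ξ-pair₁ (join d r r′)
join (I∧⁺ _ d) (ξ-pair₂ r) (ξ-pair₂ r′) = join-cong (λ t → ⟨ _ , t ⟩^ _) ξ-pair₂ (join d r r′)
join (I∨⁻ _ d) (ξ-pair₂ r) (ξ-pair₂ r′) = join-cong (λ t → ⟨ _ , t ⟩^ _) ξ-pair₂ (join d r r′)
join d (ξ-pair₁ r) (ξ-pair₂ r′) = join-step (ξ-pair₂ r′) (ξ-pair₁ r)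
join d (ξ-pair₂ r) (ξ-pair₁ r′) = join-step (ξ-pair₁ r′) (ξ-pair₂ r)
join (E∧⁺ _ d) (ξ-π r) (ξ-π r′) = join-cong (π _ _) ξ-π (join d r r′)
join (E∨⁻ _ d) (ξ-π r) (ξ-π r′) = join-cong (π _ _) ξ-π (join d r r′)
join (I∨⁺ _ d) (ξ-inj r) (ξ-inj r′) = join-cong (Term.inj _ _) ξ-inj (join d r r′)
join (I∧⁻ _ d) (ξ-inj r) (ξ-inj r′) = join-cong (Term.inj _ _) ξ-inj (join d r r′)
join (E∨⁺ d _ _) (ξ-δ₀ r) (ξ-δ₀ r′) = join-cong (λ t → δ _ t _ _ _ _) ξ-δ₀ (join d r r′)
join (E∧⁻ d _ _) (ξ-δ₀ r) (ξ-δ₀ r′) = join-cong (λ t → δ _ t _ _ _ _) ξ-δ₀ (join d r r′)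
join (E∨⁺ _ d _) (ξ-δ₁ r) (ξ-δ₁ r′) = join-cong (λ t → δ _ _ _ t _ _) ξ-δ₁ (join d r r′)
join (E∧⁻ _ d _) (ξ-δ₁ r) (ξ-δ₁ r′) = join-cong (λ t → δ _ _ _ t _ _) ξ-δ₁ (join d r r′)
join (E∨⁺ _ _ d) (ξ-δ₂ r) (ξ-δ₂ r′) = join-cong (λ t → δ _ _ _ _ _ t) ξ-δ₂ (join d r r′)
join (E∧⁻ _ _ d) (ξ-δ₂ r) (ξ-δ₂ r′) = join-cong (λ t → δ _ _ _ _ _ t) ξ-δ₂ (join d r r′)
join d (ξ-δ₀ r) (ξ-δ₁ r′) = join-step (ξ-δ₁ r′) (ξ-δ₀ r)
join d (ξ-δ₀ r) (ξ-δ₂ r′) = join-step (ξ-δ₂ r′) (ξ-δ₀ r)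
join d (ξ-δ₁ r) (ξ-δ₀ r′) = join-step (ξ-δ₀ r′) (ξ-δ₁ r)
join d (ξ-δ₁ r) (ξ-δ₂ r′) = join-step (ξ-δ₂ r′) (ξ-δ₁ r)
join d (ξ-δ₂ r) (ξ-δ₀ r′) = join-step (ξ-δ₀ r′) (ξ-δ₂ r)
join d (ξ-δ₂ r) (ξ-δ₁ r′) = join-step (ξ-δ₁ r′) (ξ-δ₂ r)
join (I¬⁺ d) (ξ-ν r) (ξ-ν r′) = join-cong (Term.ν _) ξ-ν (join d r r′)
join (I¬⁻ d) (ξ-ν r) (ξ-ν r′) = join-cong (Term.ν _) ξ-ν (join d r r′)
join (E¬⁺ d) (ξ-μ r) (ξ-μ r′) = join-cong (μ _) ξ-μ (join d r r′)
join (E¬⁻ d) (ξ-μ r) (ξ-μ r′) = join-cong (μ _) ξ-μ (join d r r′)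
join (IC⁺ d) (ξ-IC r) (ξ-IC r′) = join-cong (IC _ _) ξ-IC (join d r r′)
join (IC⁻ d) (ξ-IC r) (ξ-IC r′) = join-cong (IC _ _) ξ-IC (join d r r′)
join (EC⁺ d _) (ξ-•₁ r) (ξ-•₁ r′) = join-cong (_•⟨ _ ⟩ _) ξ-•₁ (join d r r′)
join (EC⁻ d _) (ξ-•₁ r) (ξ-•₁ r′) = join-cong (_•⟨ _ ⟩ _) ξ-•₁ (join d r r′)
join (EC⁺ _ d) (ξ-•₂ r) (ξ-•₂ r′) = join-cong (_ •⟨ _ ⟩_) ξ-•₂ (join d r r′)
join (EC⁻ _ d) (ξ-•₂ r) (ξ-•₂ r′) = join-cong (_ •⟨ _ ⟩_) ξ-•₂ (join d r r′)
join d (ξ-•₁ r) (ξ-•₂ r′) = join-step (ξ-•₂ r′) (ξ-•₁ r)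
join d (ξ-•₂ r) (ξ-•₁ r′) = join-step (ξ-•₁ r′) (ξ-•₂ r)

-- Newman's lemma by induction on `SN t`. Local confluence is available for typed terms, so subject
-- reduction carries the typing derivation along each step.
newman : ∀ {Γ : Ctx n} {t u v P} → SN t → Γ ⊢ t ∶ P → t ⟶* u → t ⟶* v → Joinable u v
newman a       d ε        rs′        = _ , rs′ , ε
newman a       d (r ◅ rs) ε          = _ , ε , r ◅ rs
newman (acc f) d (r ◅ rs) (r′ ◅ rs′) with join d r r′
... | _ , qs , qs′ with newman (f r) (⟶-⊢ d r) rs qs
...   | _ , ps , ps′ with newman (f r′) (⟶-⊢ d r′) (qs′ ◅◅ ps′) rs′
...     | _ , os , os′ = _ , ps ◅◅ os , os′

typed-SN : ∀ {Γ : Ctx n} {t P} → Γ ⊢ t ∶ P → SN t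
typed-SN d = sn⇒SN (typed-sn d)

SN-no-infinite : {t : Term n} → SN t → (f : ℕ → Term n) → f zero ≡ t → ¬ (∀ k → f k ⟶ f (suc k))
SN-no-infinite (acc g) f refl rs = SN-no-infinite (g (rs zero)) (f ∘ suc) refl (rs ∘ suc)

theorem37 : (∀ {n} {Γ : Ctx n} {t s : Term n} {P : Type} → Γ ⊢ t ∶ P → t ⟶ s → Γ ⊢ s ∶ P)
    × (∀ {n} {t : Term n} → Typable t → ¬ (Σ[ f ∈ (ℕ → Term n) ] (f zero ≡ t × (∀ (k : ℕ) → f k ⟶ f (suc k)))))
    × (∀ {n} {t₀ t₁ t₂ : Term n} → Typable t₀ → Star _⟶_ t₀ t₁ → Star _⟶_ t₀ t₂ →
    ∃[ t₃ ] (Star _⟶_ t₁ t₃ × Star _⟶_ t₂ t₃))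
theorem37 =
  ⟶-⊢ ,
  (λ { (_ , _ , d) (f , eq , rs) → SN-no-infinite (typed-SN d) f eq rs }) ,
  (λ { (_ , _ , d) → newman (typed-SN d) d })
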